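{- If $X$ and $Y$ are uncountable Polish spaces, then $\mathfrak{s}(X)=\mathfrak{s}(Y)$.
   Context: For infinite sets $U, A$, say $U$ splits $A$ if both $A\cap U$ and $A\setminus U$ are infinite. For a topological space $X$, $\mathfrak{s}(X)$ is the smallest cardinality of a family $\mathcal{U}$ of open subsets of $X$ such that every infinite $A\subseteq X$ is split by some $U\in\mathcal{U}$. -}

module Defs where

open import Data.List.Base using (List)
open import Data.List.Membership.Propositional using () renaming (_∈_ to _∈ˡ_)
open import Data.Nat.Base as ℕ using (ℕ)
open import Data.Product.Base using (∃; ∃₂; _×_; _,_)
open import Data.Rational.Base as ℚ using (ℚ; 0ℚ; 1ℚ)
import Data.Rational.Properties as ℚ
open import Function.Bundles using (_⇔_; _↣_)
open import Function.Metric.Structures using (IsGeneralMetric)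
open import Level using (0ℓ)
open import Relation.Binary.Core using (Rel)
open import Relation.Binary.PropositionalEquality.Core using (_≡_; refl; sym; cong; subst)
open import Relation.Binary.PropositionalEquality.Properties using (module ≡-Reasoning)
open import Relation.Nullary.Negation.Core using (¬_)
open import Relation.Unary using (Pred; U; _∈_; _∉_; _⊆_; _≐_; _∩_; _∖_; _≬_; ⋃; Satisfiable)

-- Sets are predicates `Pred A 0ℓ`, compared by `_≐_`.

Finite : {A : Set} → Pred (Pred A 0ℓ) 0ℓ
Finite {A} P = ∃ λ (xs : List A) → P ⊆ (_∈ˡ xs)

Infinite : {A : Set} → Pred (Pred A 0ℓ) 0ℓ
Infinite P = ¬ Finite P

-- The injection is a function on all of A, required to be injective on P only,
-- so that distinct proofs of x ∈ P are not counted as distinct elements.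
Countable : {A : Set} → Pred (Pred A 0ℓ) 0ℓ
Countable {A} P = ∃ λ (f : A → ℕ) → ∀ {x y} → x ∈ P → y ∈ P → f x ≡ f y → x ≡ y

-- Dedekind reals, given by their lower cuts.
record ℝ : Set₁ where
  field
    Lower     : Pred ℚ 0ℓ
    inhabited : ∃ λ p → p ∈ Lower
    bounded   : ∃ λ p → p ∉ Lower
    closed    : ∀ {p q} → p ℚ.< q → q ∈ Lower → p ∈ Lower
    open′     : ∀ {p} → p ∈ Lower → ∃ λ q → p ℚ.< q × q ∈ Lower

open ℝ

infix 4 _≈_ _≤_ _<_

_≈_ : Rel ℝ 0ℓ
x ≈ y = Lower x ≐ Lower y

_≤_ : Rel ℝ 0ℓ
x ≤ y = Lower x ⊆ Lower y

_<_ : Rel ℝ 0ℓ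
x < y = ∃ λ q → q ∉ Lower x × q ∈ Lower y

0ℝ : ℝ
0ℝ = record
  { Lower     = ℚ._< 0ℚ
  ; inhabited = ℚ.- 1ℚ , ℚ.neg-antimono-< (ℚ.positive⁻¹ 1ℚ)
  ; bounded   = 0ℚ , ℚ.<-irrefl refl
  ; closed    = ℚ.<-trans
  ; open′     = ℚ.<-dense
  }

private
  cancel : ∀ p r → p ℚ.+ (r ℚ.- p) ≡ r
  cancel p r = begin
    p ℚ.+ (r ℚ.+ ℚ.- p)  ≡⟨ cong (p ℚ.+_) (ℚ.+-comm r (ℚ.- p)) ⟩
    p ℚ.+ (ℚ.- p ℚ.+ r)  ≡⟨ ℚ.+-assoc p (ℚ.- p) r ⟨
    (p ℚ.+ ℚ.- p) ℚ.+ r  ≡⟨ cong (ℚ._+ r) (ℚ.+-inverseʳ p) ⟩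
    0ℚ ℚ.+ r             ≡⟨ ℚ.+-identityˡ r ⟩
    r                    ∎
    where open ≡-Reasoning

  cancel′ : ∀ p q → (p ℚ.+ q) ℚ.- p ≡ q
  cancel′ p q = begin
    (p ℚ.+ q) ℚ.+ ℚ.- p  ≡⟨ ℚ.+-assoc p q (ℚ.- p) ⟩
    p ℚ.+ (q ℚ.- p)      ≡⟨ cancel p q ⟩
    q                    ∎
    where open ≡-Reasoning

  below : ∀ x {p u} → p ∈ Lower x → u ∉ Lower x → p ℚ.< u
  below x {p} {u} p∈x u∉x = ℚ.≰⇒> λ u≤p → u∉x (let (q , p<q , q∈x) = open′ x p∈x in
    closed x (ℚ.≤-<-trans u≤p p<q) q∈x)

infixl 6 _+_

_+_ : ℝ → ℝ → ℝ
x + y = record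
  { Lower     = λ r → ∃₂ λ p q → p ∈ Lower x × q ∈ Lower y × r ≡ p ℚ.+ q
  ; inhabited = let (p , p∈x) = inhabited x ; (q , q∈y) = inhabited y in
      p ℚ.+ q , p , q , p∈x , q∈y , refl
  ; bounded   = let (u , u∉x) = bounded x ; (v , v∉y) = bounded y in
      u ℚ.+ v , λ (p , q , p∈x , q∈y , eq) →
        ℚ.<-irrefl (sym eq) (ℚ.+-mono-< (below x p∈x u∉x) (below y q∈y v∉y))
  ; closed    = λ { {r} r<s (p , q , p∈x , q∈y , refl) →
      p , r ℚ.- p , p∈x ,
      closed y (subst (r ℚ.- p ℚ.<_) (cancel′ p q) (ℚ.+-monoˡ-< (ℚ.- p) r<s)) q∈y ,
      sym (cancel p r) }
  ; open′     = λ { (p , q , p∈x , q∈y , refl) →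
      let (p′ , p<p′ , p′∈x) = open′ x p∈x in
      p′ ℚ.+ q , ℚ.+-monoˡ-< q p<p′ , p′ , q , p′∈x , q∈y , refl }
  }

-- Unions range over families indexed by a `Set`.  Classically this covers every
-- collection of subsets, since up to `_≐_` there are only `Carrier → Bool` many.
record Space : Set₁ where
  field
    Carrier   : Set
    Open      : Pred (Pred Carrier 0ℓ) 0ℓ
    open-resp : ∀ {V W} → V ≐ W → Open V → Open W
    open-U    : Open U
    open-∩    : ∀ {V W} → Open V → Open W → Open (V ∩ W)
    open-⋃    : ∀ (I : Set) (V : I → Pred Carrier 0ℓ) → (∀ i → Open (V i)) → Open (⋃ I V)

module _ {A : Set} where

  IsMetric : (A → A → ℝ) → Set₁
  IsMetric = IsGeneralMetric _≡_ _≈_ _≤_ 0ℝ _+_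

  MetricOpen : (A → A → ℝ) → Pred A 0ℓ → Set₁
  MetricOpen d V = ∀ {x} → x ∈ V → ∃ λ ε → 0ℝ < ε × (∀ {y} → d x y < ε → y ∈ V)

  Cauchy : (A → A → ℝ) → (ℕ → A) → Set₁
  Cauchy d s = ∀ ε → 0ℝ < ε → ∃ λ N → ∀ m n → N ℕ.≤ m → N ℕ.≤ n → d (s m) (s n) < ε

  ConvergesTo : (A → A → ℝ) → (ℕ → A) → A → Set₁
  ConvergesTo d s x = ∀ ε → 0ℝ < ε → ∃ λ N → ∀ n → N ℕ.≤ n → d (s n) x < ε

  Complete : (A → A → ℝ) → Set₁
  Complete d = ∀ s → Cauchy d s → ∃ λ x → ConvergesTo d s x

module _ (X : Space) where
  open Space X

  Dense : Pred Carrier 0ℓ → Set₁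
  Dense D = ∀ V → Open V → Satisfiable V → V ≬ D

  Separable : Set₁
  Separable = ∃ λ D → Countable D × Dense D

  CompletelyMetrizable : Set₁
  CompletelyMetrizable =
    ∃ λ d → IsMetric d × Complete d × (∀ V → Open V ⇔ MetricOpen d V)

  Polish : Set₁
  Polish = Separable × CompletelyMetrizable

  Uncountable : Set
  Uncountable = ¬ Countable {Carrier} U

_Splits_ : {A : Set} → Pred A 0ℓ → Pred A 0ℓ → Set
V Splits A = Infinite (A ∩ V) × Infinite (A ∖ V)

-- A splitting family of cardinality κ: a set of open sets enumerated by κ
-- without repetition.
record SplittingFamily (X : Space) (κ : Set) : Set₁ where
  open Space X
  field
    member   : κ → Pred Carrier 0ℓ
    distinct : ∀ {i j} → member i ≐ member j → i ≡ j
    isOpen   : ∀ i → Open (member i)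
    splits   : ∀ A → Infinite A → ∃ λ i → member i Splits A

-- `κ Is𝔰 X` : the cardinal of κ is 𝔰(X).  Cardinals are represented by types,
-- and |κ| ≤ |μ| by `κ ↣ μ`, so κ is determined up to bijection.
_Is𝔰_ : Set → Space → Set₁
κ Is𝔰 X = SplittingFamily X κ × (∀ μ → SplittingFamily X μ → κ ↣ μ)

{-# OPTIONS --safe #-}
-- Both directions are compared with the Cantor space C = ℕ → Bool; s(X) only
-- depends on which injective sequences of points are split.
--
-- s(C) ≤ s(X): if X is uncountable Polish, splitting uncountable sets at two
-- condensation points yields a continuous injection C → X, and preimages of a
-- splitting family of X split all sequences in C.
--
-- s(X) ≤ s(C): the balls around a dense sequence, with radii chosen from a
-- parameter t ∈ ω₁, code by points of C all points of X that lie on none of the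
-- bounding spheres, and preimages of open sets under the coding extend to open
-- sets of X.  The radii for different t are distinct, so each point is bad for
-- only countably many t, and some t is good for a whole given sequence.  This
-- bounds s(X) by s(C) · ℵ₁, which is s(C) because no countable family splits all
-- sequences.

module Submission where

open import Axiom.ExcludedMiddle using (ExcludedMiddle)
open import Axiom.Extensionality.Propositional using (Extensionality)
open import Data.Product.Base using (∃-syntax; _×_)
open import Defs

open import Data.Bool.Base using (Bool; true; false; not; if_then_else_)
import Data.Bool.Properties as Bool
open import Data.Empty using (⊥; ⊥-elim)
import Data.Integer.Base as ℤ
import Data.Integer.Properties as ℤ
open import Data.List.Base as List using (List; []; _∷_)
open import Data.List.Membership.Propositional using () renaming (_∈_ to _∈ˡ_; _∉_ to _∉ˡ_)
import Data.List.Membership.Propositional.Properties as List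
open import Data.List.Relation.Unary.Any using (here; there)
open import Data.Maybe.Base using (Maybe; just; nothing)
open import Data.Maybe.Properties using (just-injective)
open import Data.Nat.Base as ℕ using (ℕ; zero; suc)
open import Data.Nat.Coprimality using (1-coprimeTo)
import Data.Nat.Properties as ℕ
open import Data.Product.Base using (∃; ∃₂; _,_; proj₁; proj₂)
open import Data.Product.Properties using (,-injective; ,-injectiveˡ; ,-injectiveʳ)
open import Data.Rational.Base as ℚ using (ℚ; 0ℚ; 1ℚ; mkℚ)
import Data.Rational.Properties as ℚ
open import Data.Sum.Base as Sum using (_⊎_; inj₁; inj₂)
open import Data.Sum.Properties using (inj₂-injective)
open import Data.Unit.Base using (⊤; tt)
open import Function.Base using (_∘_; id; case_of_)
open import Function.Bundles using (_↣_; mk↣; module Injection; _⇔_; mk⇔; module Equivalence)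
open import Function.Construct.Composition using (_↣-∘_)
open import Function.Metric.Structures using (IsGeneralMetric)
open import Induction.WellFounded using (WellFounded; Acc; acc; module All; module FixPoint)
open import Level using (Level; 0ℓ; _⊔_)
import Relation.Binary.Construct.On as InverseImage
open import Relation.Binary.Core using (Rel)
open import Relation.Binary.Definitions using (tri<; tri≈; tri>)
open import Relation.Binary.PropositionalEquality
  using (_≡_; _≢_; refl; sym; trans; cong; cong₂; subst; module ≡-Reasoning)
open import Relation.Binary.PropositionalEquality.WithK using (≡-irrelevant)
open import Relation.Nullary using (yes; no; does; ¬_; contradiction)
open import Relation.Nullary.Decidable using (dec-true; decidable-stable)
open import Relation.Unary using (Pred; U; _∈_; _∉_; _⊆_; _∩_; _∖_; ⋃)

-- Two obstacles shape the argument. A connected X, such as the real line, has only constant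
-- continuous maps to C, so no coding by points of C can be continuous on all of X; the points where
-- it fails must depend on a parameter, so that any given sequence can avoid them. The parameters
-- are indexed by ω₁ rather than by all reals: a continuum of parameters would only bound s(X) by
-- the continuum, whereas ℵ₁ is absorbed by every uncountable cardinal. Since cardinals are types
-- here, the facts about them are proved for types. Choice comes from `em`, which decides sigma
-- types and so returns witnesses.

private
  variable
    a b p q : Level
    A B : Set a

open Injection using (to; injective)

infix 10 _⟪_⟫
_⟪_⟫ : A ↣ B → A → B
_⟪_⟫ = to

module Classical (em : ∀ {ℓ} → ExcludedMiddle ℓ) (ext : ∀ {a b} → Extensionality a b) where

  -- Classical reasoning and characteristic functions

  by-contradiction : {P : Set p} → ¬ ¬ P → P
  by-contradiction = decidable-stable em

  ¬∀⟶∃¬ : {A : Set a} {P : Pred A p} → ¬ (∀ x → P x) → ∃ λ x → ¬ P x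
  ¬∀⟶∃¬ ¬∀ = by-contradiction λ ∄ → ¬∀ λ x → by-contradiction λ ¬Px → ∄ (x , ¬Px)

  -- `Pred A 0ℓ` lies one universe up, whereas `A → Bool` is again a `Set`. These codes let small
  -- types index families of subsets, and by extensionality coextensive predicates have equal codes.
  χ : {A : Set a} → Pred A p → A → Bool
  χ P x = does (em {P = P x})

  χ⁺ : {A : Set a} (P : Pred A p) {x : A} → P x → χ P x ≡ true
  χ⁺ P = dec-true em

  χ⁻ : {A : Set a} (P : Pred A p) {x : A} → χ P x ≡ true → P x
  χ⁻ P {x} eq with yes Px ← em {P = P x} = Px

  χ⁻-false : {A : Set a} (P : Pred A p) {x : A} → χ P x ≡ false → ¬ P x
  χ⁻-false P {x} eq with no ¬Px ← em {P = P x} = ¬Px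

  χ⁺-false : {A : Set a} (P : Pred A p) {x : A} → ¬ P x → χ P x ≡ false
  χ⁺-false P {x} ¬Px with em {P = P x}
  ... | yes Px = contradiction Px ¬Px
  ... | no _   = refl

  Bool-ext : {f g : A → Bool} → (∀ x → f x ≡ true → g x ≡ true) →
             (∀ x → g x ≡ true → f x ≡ true) → f ≡ g
  Bool-ext {f = f} {g} f⇒g g⇒f = ext λ x → Bool.⇔→≡ (mk⇔ (f⇒g x) (g⇒f x))

  χ-cong : {A : Set a} {P : Pred A p} {Q : Pred A q} → P ⊆ Q → Q ⊆ P → χ P ≡ χ Q
  χ-cong {P = P} {Q} P⊆Q Q⊆P =
    Bool-ext (λ _ → χ⁺ Q ∘ P⊆Q ∘ χ⁻ P) (λ _ → χ⁺ P ∘ Q⊆P ∘ χ⁻ Q)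

  -- Well-orders and maximal cliques

  record WellOrder (A : Set) : Set₁ where
    infix 4 _≺_
    field
      _≺_     : Rel A 0ℓ
      ≺-irr   : ∀ {x y} (x≺y x≺y′ : x ≺ y) → x≺y ≡ x≺y′
      wf      : WellFounded _≺_
      ≺-cmp   : ∀ x y → x ≺ y ⊎ x ≡ y ⊎ y ≺ x

    -- Transfinite recursion in which each value only has to satisfy a
    -- constraint relative to the earlier values.
    transfinite-choice : {B : Set b} (Q : ∀ x → (∀ y → y ≺ x → B) → B → Set q) →
      (∀ x prev → ∃ (Q x prev)) → ∃ λ f → ∀ x → Q x (λ y _ → f y) (f x)
    transfinite-choice {b = b} {B = B} Q choose = f , λ x →
      subst (Q x λ y _ → f y) (sym (FixPoint.unfold-wfRec wf (λ _ → B) step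
        (λ x eq → cong (proj₁ ∘ choose x) (ext λ y → ext λ y≺x → eq y≺x))))
        (proj₂ (choose x _))
      where
      step : ∀ x → (∀ {y} → y ≺ x → B) → B
      step x prev = proj₁ (choose x λ y y≺x → prev {y} y≺x)
      f : A → B
      f = All.wfRec wf b (λ _ → B) step

  -- Zermelo's theorem.  A stage is reached by transfinitely often adding one
  -- further element to a subset of A; the stages are linearly ordered by
  -- inclusion, and x precedes y when x is present in the stage that y is added to.
  module Zermelo (A : Set) where

    -- `sup I f` denotes the union of the successors of the `f i`, so empty, successor and limit
    -- stages are instances of one constructor.
    data Stage : Set₁ where
      sup : (I : Set) → (I → Stage) → Stage

    -- The argument is a characteristic function, not a stage, so that coextensive stages pick the
    -- same element.
    pick : (A → Bool) → Maybe A
    pick S with em {P = ∃ λ x → S x ≡ false}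
    ... | yes (x , _) = just x
    ... | no _        = nothing

    ⟦_⟧ ⟦_⟧⁺ : Stage → Pred A 0ℓ
    ⟦ sup I f ⟧ x = ∃ λ i → ⟦ f i ⟧ x ⊎ pick (χ ⟦ f i ⟧) ≡ just x
    ⟦ α ⟧⁺ x = ⟦ α ⟧ x ⊎ pick (χ ⟦ α ⟧) ≡ just x

    pick-fresh : ∀ α {x} → pick (χ ⟦ α ⟧) ≡ just x → ¬ ⟦ α ⟧ x
    pick-fresh α eq with em {P = ∃ λ x → χ ⟦ α ⟧ x ≡ false}
    pick-fresh α refl | yes (x , eq) = χ⁻-false ⟦ α ⟧ eq

    -- If the successor of some `f i` is not inside `β`, compare `f i` and `β` both ways: either the
    -- successor of `β` is inside `f i`, or the two coincide and pick the same element. The swapped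
    -- call terminates since `f i` has replaced its parent and `β` is unchanged.
    linear : ∀ α β → ⟦ α ⟧ ⊆ ⟦ β ⟧ ⊎ ⟦ β ⟧⁺ ⊆ ⟦ α ⟧
    linear (sup I f) β with em {P = ∃ λ i → ¬ (⟦ f i ⟧⁺ ⊆ ⟦ β ⟧)}
    ... | no ∄ = inj₁ λ (i , x∈) → by-contradiction λ x∉β → ∄ (i , λ fi⁺⊆β → x∉β (fi⁺⊆β x∈))
    ... | yes (i , fi⁺⊈β) with linear (f i) β | linear β (f i)
    ...   | inj₂ β⁺⊆fi | _          = inj₂ λ x∈β⁺ → i , inj₁ (β⁺⊆fi x∈β⁺)
    ...   | inj₁ _     | inj₂ fi⁺⊆β = ⊥-elim (fi⁺⊈β fi⁺⊆β)
    ...   | inj₁ fi⊆β  | inj₁ β⊆fi  = inj₂ λ where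
      (inj₁ x∈β) → i , inj₁ (β⊆fi x∈β)
      (inj₂ eq)  → i , inj₂ (trans (cong pick (χ-cong fi⊆β β⊆fi)) eq)

    added : ∀ α {x} → ⟦ α ⟧ x → ∃ λ β → pick (χ ⟦ β ⟧) ≡ just x
    added (sup I f) (i , inj₁ x∈fi) = added (f i) x∈fi
    added (sup I f) (i , inj₂ eq)   = f i , eq

    IsStage : Pred (A → Bool) _
    IsStage S = ∃ λ α → χ ⟦ α ⟧ ≡ S

    -- `Stage` is too large to index a `sup`, but the codes of stages are not. The code of `final`
    -- is among them, so the successor of `final` adds nothing.
    final : Stage
    final = sup (∃ λ S → χ IsStage S ≡ true) λ (S , eq) → proj₁ (χ⁻ IsStage eq)

    final⁺⊆final : ⟦ final ⟧⁺ ⊆ ⟦ final ⟧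
    final⁺⊆final (inj₁ x∈) = x∈
    final⁺⊆final (inj₂ eq) = (χ ⟦ final ⟧ , isStage) ,
      inj₂ (trans (cong pick (proj₂ (χ⁻ IsStage isStage))) eq)
      where isStage = χ⁺ IsStage (final , refl)

    final-full : ∀ x → ⟦ final ⟧ x
    final-full x with em {P = ∃ λ y → χ ⟦ final ⟧ y ≡ false} in eq
    ... | no ∄  = by-contradiction λ x∉ → ∄ (x , χ⁺-false ⟦ final ⟧ x∉)
    ... | yes (y , y∉) = contradiction (final⁺⊆final (inj₂ pick≡y)) (pick-fresh final pick≡y)
      where
      pick≡y : pick (χ ⟦ final ⟧) ≡ just y
      pick≡y rewrite eq = refl

    rank : A → Stage
    rank x = proj₁ (added final (final-full x))

    pick-rank : ∀ x → pick (χ ⟦ rank x ⟧) ≡ just x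
    pick-rank x = proj₂ (added final (final-full x))

    _≺_ : Rel A 0ℓ
    x ≺ y = χ ⟦ rank y ⟧ x ≡ true

    rank-irrefl : ∀ x → ¬ ⟦ rank x ⟧ x
    rank-irrefl x = pick-fresh (rank x) (pick-rank x)

    -- If `f i` picks x, comparison puts `rank x` inside `f i`, since otherwise x would lie in its
    -- own rank. The predecessors of x thus belong to a smaller stage.
    accessible : ∀ α {x} → ⟦ α ⟧ x → Acc _≺_ x
    accessible (sup I f) (i , inj₁ x∈fi) = accessible (f i) x∈fi
    accessible (sup I f) {x} (i , inj₂ eq) = acc λ y≺x → accessible (f i) (rank⊆fi (χ⁻ ⟦ rank x ⟧ y≺x))
      where
      rank⊆fi : ⟦ rank x ⟧ ⊆ ⟦ f i ⟧
      rank⊆fi with linear (rank x) (f i)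
      ... | inj₁ rank⊆fi = rank⊆fi
      ... | inj₂ fi⁺⊆rank = contradiction (fi⁺⊆rank (inj₂ eq)) (rank-irrefl x)

    wellOrder : WellOrder A
    wellOrder = record
      { _≺_     = _≺_
      ; ≺-irr   = ≡-irrelevant
      ; wf      = λ x → accessible final (final-full x)
      ; ≺-cmp   = cmp
      }
      where
      cmp : ∀ x y → x ≺ y ⊎ x ≡ y ⊎ y ≺ x
      cmp x y with linear (rank x) (rank y) | linear (rank y) (rank x)
      ... | inj₂ y⁺⊆x | _         = inj₂ (inj₂ (χ⁺ ⟦ rank x ⟧ (y⁺⊆x (inj₂ (pick-rank y)))))
      ... | _         | inj₂ x⁺⊆y = inj₁ (χ⁺ ⟦ rank y ⟧ (x⁺⊆y (inj₂ (pick-rank x))))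
      ... | inj₁ x⊆y  | inj₁ y⊆x  = inj₂ (inj₁ (just-injective
        (trans (sym (pick-rank x)) (trans (cong pick (χ-cong x⊆y y⊆x)) (pick-rank y)))))

  wellOrder : (A : Set) → WellOrder A
  wellOrder = Zermelo.wellOrder

  -- Greedy choice along a well-order, in place of Zorn's lemma: x is kept when every earlier kept
  -- element is related to it.
  maximal-clique : {A : Set} (_~_ : Rel A 0ℓ) → (∀ {x y} → x ~ y → y ~ x) →
    ∃ λ (R : Pred A 0ℓ) → (∀ {x y} → x ∈ R → y ∈ R → x ≢ y → x ~ y) ×
                          (∀ {x} → (∀ {y} → y ∈ R → y ~ x) → x ∈ R)
  maximal-clique {A} _~_ ~-sym = R , clique , λ {x} x~R → Equivalence.from (greedy x) λ y _ → x~R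
    where
    open WellOrder (wellOrder A)
    clique-choice = transfinite-choice {B = Bool}
      (λ x prev b → (b ≡ true) ⇔ (∀ y (y≺x : y ≺ x) → prev y y≺x ≡ true → y ~ x))
      λ x prev → let Q = λ (_ : ⊤) → ∀ y (y≺x : y ≺ x) → prev y y≺x ≡ true → y ~ x in
        χ Q tt , mk⇔ (χ⁻ Q) (χ⁺ Q)
    R : Pred A 0ℓ
    R x = proj₁ clique-choice x ≡ true
    greedy : ∀ x → R x ⇔ (∀ y → y ≺ x → R y → y ~ x)
    greedy = proj₂ clique-choice
    clique : ∀ {x y} → x ∈ R → y ∈ R → x ≢ y → x ~ y
    clique {x} {y} x∈R y∈R x≢y with ≺-cmp x y
    ... | inj₁ x≺y        = Equivalence.to (greedy y) y∈R x x≺y x∈R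
    ... | inj₂ (inj₁ x≡y) = contradiction x≡y x≢y
    ... | inj₂ (inj₂ y≺x) = ~-sym (Equivalence.to (greedy x) x∈R y y≺x y∈R)

  -- Countable sets and cardinal arithmetic with ω₁

  module Pairing where
    next : ℕ × ℕ → ℕ × ℕ
    next (m , suc n) = suc m , n
    next (m , zero)  = zero , suc m

    unpair : ℕ → ℕ × ℕ
    unpair zero    = 0 , 0
    unpair (suc k) = next (unpair k)

    unpair-surj : ∀ s m n → m ℕ.+ n ≡ s → ∃ λ k → unpair k ≡ (m , n)
    unpair-surj s (suc m) n eq =
      let k , eq′ = unpair-surj s m (suc n) (trans (ℕ.+-suc m n) eq) in suc k , cong next eq′
    unpair-surj _ zero zero _ = 0 , refl
    unpair-surj (suc s) zero (suc .s) refl =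
      let k , eq = unpair-surj s s 0 (ℕ.+-identityʳ s) in suc k , cong next eq

  abstract
    ℕ×ℕ↣ℕ : (ℕ × ℕ) ↣ ℕ
    ℕ×ℕ↣ℕ = mk↣ {to = λ (m , n) → proj₁ (unpair-surj _ m n refl)} λ {(m , n)} {(m′ , n′)} eq →
      trans (sym (proj₂ (unpair-surj _ m n refl)))
        (trans (cong unpair eq) (proj₂ (unpair-surj _ m′ n′ refl)))
      where open Pairing

  open Pairing using (unpair; unpair-surj)

  pair : ℕ → ℕ → ℕ
  pair m n = ℕ×ℕ↣ℕ ⟪ m , n ⟫

  pair-injective : ∀ {m n m′ n′} → pair m n ≡ pair m′ n′ → m ≡ m′ × n ≡ n′
  pair-injective eq = ,-injective (injective ℕ×ℕ↣ℕ eq)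

  InjectiveOn : {A : Set} {B : Set b} → Pred A p → (A → B) → Set _
  InjectiveOn P f = ∀ {x y} → x ∈ P → y ∈ P → f x ≡ f y → x ≡ y

  countable-⋃ : {A : Set} {J : Set p} {S : Pred A 0ℓ} (P : J → Pred A 0ℓ) →
    J ↣ ℕ → (∀ j → Countable (P j)) → (∀ {x} → x ∈ S → ∃ λ j → x ∈ P j) → Countable S
  countable-⋃ {A = A} {J} {S} P code countable locate = f , f-inj
    where
    f : A → ℕ
    f x with em {P = ∃ λ j → x ∈ P j}
    ... | yes (j , _) = pair (code ⟪ j ⟫) (proj₁ (countable j) x)
    ... | no _        = 0
    f-inj : InjectiveOn S f
    f-inj {x} {y} x∈S y∈S eq with em {P = ∃ λ j → x ∈ P j} | em {P = ∃ λ j → y ∈ P j}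
    ... | no ∄ | _    = contradiction (locate x∈S) ∄
    ... | _    | no ∄ = contradiction (locate y∈S) ∄
    ... | yes (j , x∈Pj) | yes (k , y∈Pk)
      with refl ← injective code (proj₁ (pair-injective eq)) =
      proj₂ (countable j) x∈Pj y∈Pk (proj₂ (pair-injective eq))

  countable-⊆ : {A : Set} {P Q : Pred A 0ℓ} → P ⊆ Q → Countable Q → Countable P
  countable-⊆ P⊆Q (f , f-inj) = f , λ x∈P y∈P → f-inj (P⊆Q x∈P) (P⊆Q y∈P)

  finite⇒countable : {A : Set} {P : Pred A 0ℓ} → Finite P → Countable P
  finite⇒countable {A} (xs , P⊆xs) = countable-⊆ P⊆xs (index xs , index-inj xs)
    where
    index : List A → A → ℕ
    index [] x = 0
    index (y ∷ ys) x with em {P = x ≡ y}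
    ... | yes _ = 0
    ... | no _  = suc (index ys x)
    index-inj : ∀ xs → InjectiveOn (_∈ˡ xs) (index xs)
    index-inj (z ∷ zs) {x} {y} x∈ y∈ eq with em {P = x ≡ z} | em {P = y ≡ z}
    ... | yes refl | yes refl = refl
    ... | no x≢z   | no y≢z   = index-inj zs (tail x≢z x∈) (tail y≢z y∈) (ℕ.suc-injective eq)
      where
      tail : ∀ {w} → w ≢ z → w ∈ˡ z ∷ zs → w ∈ˡ zs
      tail w≢z (here w≡z) = contradiction w≡z w≢z
      tail w≢z (there w∈) = w∈

  ordered-injective : {f : ℕ → A} → (∀ {m n} → m ℕ.< n → f m ≢ f n) → ∀ {m n} → f m ≡ f n → m ≡ n
  ordered-injective f≢ {m} {n} eq with ℕ.<-cmp m n
  ... | tri< m<n _ _ = contradiction eq (f≢ m<n)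
  ... | tri≈ _ m≡n _ = m≡n
  ... | tri> _ _ n<m = contradiction (sym eq) (f≢ n<m)

  infinite⇒sequence : {A : Set} {P : Pred A 0ℓ} → Infinite P → ∃ λ (s : ℕ ↣ A) → ∀ n → s ⟪ n ⟫ ∈ P
  infinite⇒sequence {A} {P} inf = mk↣ (ordered-injective s-fresh) , λ n → proj₁ (proj₂ (fresh (prefix n)))
    where
    fresh : ∀ xs → ∃ λ x → x ∈ P × x ∉ˡ xs
    fresh xs = by-contradiction λ ∄ →
      inf (xs , λ {x} x∈P → by-contradiction λ x∉xs → ∄ (x , x∈P , x∉xs))
    prefix : ℕ → List A
    prefix zero    = []
    prefix (suc n) = proj₁ (fresh (prefix n)) ∷ prefix n
    s : ℕ → A
    s n = proj₁ (fresh (prefix n))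
    s∈prefix : ∀ {m n} → m ℕ.<′ n → s m ∈ˡ prefix n
    s∈prefix ℕ.<′-base       = here refl
    s∈prefix (ℕ.≤′-step m<n) = there (s∈prefix m<n)
    s-fresh : ∀ {m n} → m ℕ.< n → s m ≢ s n
    s-fresh {m} {n} m<n eq =
      proj₂ (proj₂ (fresh (prefix n))) (subst (_∈ˡ prefix n) eq (s∈prefix (ℕ.<⇒<′ m<n)))

  uncountable⇒sequence : {A : Set} → ¬ Countable {A} U → ℕ ↣ A
  uncountable⇒sequence unc = proj₁ (infinite⇒sequence (unc ∘ finite⇒countable))

  cantor : ¬ Countable {ℕ → Bool} U
  cantor (f , f-inj) = Bool.not-¬ refl (diag-f diag)
    where
    diag : ℕ → Bool
    diag n with em {P = ∃ λ x → f x ≡ n}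
    ... | yes (x , _) = not (x n)
    ... | no _        = true
    diag-f : ∀ x → diag (f x) ≡ not (x (f x))
    diag-f x with em {P = ∃ λ y → f y ≡ f x}
    ... | yes (y , eq) = cong (λ z → not (z (f x))) (f-inj tt tt eq)
    ... | no ∄         = contradiction (x , refl) ∄

  -- The first uncountable ordinal, cut out of a well-order of ℕ → Bool.
  module ω₁ where
    private
      module O = WellOrder (wellOrder (ℕ → Bool))

    HasCountableSegment : Pred (ℕ → Bool) 0ℓ
    HasCountableSegment x = Countable (O._≺ x)

    -- A proof of `Countable` carries an enumeration; membership through `χ` has at most one proof,
    -- so elements of `T` are equal once their underlying points are.
    T : Set
    T = ∃ λ x → χ HasCountableSegment x ≡ true

    T-≡ : {s t : T} → proj₁ s ≡ proj₁ t → s ≡ t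
    T-≡ {x , p} {.x , q} refl = cong (x ,_) (≡-irrelevant p q)

    order : WellOrder T
    order = record
      { _≺_     = λ s t → proj₁ s O.≺ proj₁ t
      ; ≺-irr   = O.≺-irr
      ; wf      = InverseImage.wellFounded proj₁ O.wf
      ; ≺-cmp   = λ s t → Sum.map₂ (Sum.map₁ T-≡) (O.≺-cmp (proj₁ s) (proj₁ t))
      }
    open WellOrder order public

    countable-segment : ∀ t → Countable (_≺ t)
    countable-segment (x , q) = let f , f-inj = χ⁻ HasCountableSegment q in
      f ∘ proj₁ , λ s≺t s′≺t → T-≡ ∘ f-inj s≺t s′≺t

    -- Otherwise induction along the well-order gives every point a countable segment, making all of
    -- `ℕ → Bool` countable.
    uncountable : ¬ Countable {T} U
    uncountable (f , f-inj) = cantor (countable-⊆ (λ {x} _ → all x) small)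
      where
      f′ : (ℕ → Bool) → ℕ
      f′ x with em {P = χ HasCountableSegment x ≡ true}
      ... | yes p = f (x , p)
      ... | no _  = 0
      small : Countable HasCountableSegment
      small = f′ , inj
        where
        inj : InjectiveOn HasCountableSegment f′
        inj {x} {y} px py eq with em {P = χ HasCountableSegment x ≡ true}
                                | em {P = χ HasCountableSegment y ≡ true}
        ... | yes p | yes q = cong proj₁ (f-inj tt tt eq)
        ... | no ¬p | _     = contradiction (χ⁺ HasCountableSegment px) ¬p
        ... | _     | no ¬q = contradiction (χ⁺ HasCountableSegment py) ¬q
      all : ∀ x → HasCountableSegment x
      all = All.wfRec O.wf 0ℓ HasCountableSegment λ _ below → countable-⊆ (λ {y} → below {y}) small

    minimal : {B : Set} {P : Pred B 0ℓ} → ¬ Countable P → ∃ λ (f : T ↣ B) → ∀ t → f ⟪ t ⟫ ∈ P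
    minimal {B} {P} unc = let f , f-spec = transfinite-choice
                                  (λ t prev b → b ∈ P × (∀ s (s≺t : s ≺ t) → prev s s≺t ≢ b)) choose in
      mk↣ (λ {s} {t} eq → case ≺-cmp s t of λ where
        (inj₁ s≺t)        → contradiction eq (proj₂ (f-spec t) s s≺t)
        (inj₂ (inj₁ s≡t)) → s≡t
        (inj₂ (inj₂ t≺s)) → contradiction (sym eq) (proj₂ (f-spec s) t t≺s))
      , proj₁ ∘ f-spec
      where
      choose : ∀ t (prev : ∀ s → s ≺ t → B) → ∃ λ b → b ∈ P × (∀ s (s≺t : s ≺ t) → prev s s≺t ≢ b)
      choose t prev = by-contradiction λ ∄ → unc (countable-⋃ {J = ∃ (_≺ t)}
        (λ (s , s≺t) → prev s s≺t ≡_)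
        (mk↣ {to = e ∘ proj₁} λ {(s , s≺t)} {(s′ , s′≺t)} eq → pair≡ s≺t s′≺t (e-inj s≺t s′≺t eq))
        (λ _ → (λ _ → 0) , λ eq eq′ _ → trans (sym eq) eq′)
        λ {b} b∈P → by-contradiction λ ∄s →
          ∄ (b , b∈P , λ s s≺t eq → ∄s ((s , s≺t) , eq)))
        where
        e = proj₁ (countable-segment t)
        e-inj : InjectiveOn (_≺ t) e
        e-inj = proj₂ (countable-segment t)
        pair≡ : ∀ {s s′} (p : s ≺ t) (q : s′ ≺ t) → s ≡ s′ → (s , p) ≡ (s′ , q)
        pair≡ {s} p q refl = cong (s ,_) (≺-irr {s} {t} p q)

  -- Absorption of a factor S by K

  module _ {S K : Set} (S×S↣S : (S × S) ↣ S) (s₀ s₁ : S) (s₀≢s₁ : s₀ ≢ s₁) where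

    merge : (S ⊎ S) × S → S
    merge (inj₁ s , t) = S×S↣S ⟪ s₀ , S×S↣S ⟪ s , t ⟫ ⟫
    merge (inj₂ s , t) = S×S↣S ⟪ s₁ , S×S↣S ⟪ s , t ⟫ ⟫

    merge-injective : ∀ {u v} → merge u ≡ merge v → u ≡ v
    merge-injective {inj₁ s , t} {inj₁ s′ , t′} eq
      with refl ← injective S×S↣S (,-injectiveʳ (injective S×S↣S eq)) = refl
    merge-injective {inj₂ s , t} {inj₂ s′ , t′} eq
      with refl ← injective S×S↣S (,-injectiveʳ (injective S×S↣S eq)) = refl
    merge-injective {inj₁ _ , _} {inj₂ _ , _} eq =
      contradiction (,-injectiveˡ (injective S×S↣S eq)) s₀≢s₁
    merge-injective {inj₂ _ , _} {inj₁ _ , _} eq =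
      contradiction (sym (,-injectiveˡ (injective S×S↣S eq))) s₀≢s₁

    -- Split K into a maximal disjoint family of copies of S and a remainder
    -- that embeds in a single copy.
    absorb : S ↣ K →
      ((D : Pred K 0ℓ) → ¬ (∃ λ (e : S ↣ K) → ∀ s → e ⟪ s ⟫ ∈ D) →
        ∃ λ (g : K → S) → InjectiveOn D g) →
      (K × S) ↣ K
    absorb e∗ small = mk↣ {to = F} F-inj
      where
      _~_ : Rel (S ↣ K) 0ℓ
      e ~ e′ = ∀ s s′ → e ⟪ s ⟫ ≢ e′ ⟪ s′ ⟫
      family = maximal-clique _~_ (λ e~e′ s s′ eq → e~e′ s′ s (sym eq))
      R : Pred (S ↣ K) 0ℓ
      R = proj₁ family
      disjoint : ∀ {e e′} → e ∈ R → e′ ∈ R → e ≢ e′ → e ~ e′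
      disjoint = proj₁ (proj₂ family)
      maximal : ∀ {e} → (∀ {e′} → e′ ∈ R → e′ ~ e) → e ∈ R
      maximal = proj₂ (proj₂ family)
      Copy : Pred K 0ℓ
      Copy x = ∃ λ e → e ∈ R × ∃ λ s → e ⟪ s ⟫ ≡ x
      nonempty : ∃ R
      nonempty = by-contradiction λ ∄ → ∄ (e∗ , maximal λ {e} e∈R → contradiction (e , e∈R) ∄)
      e₀ = proj₁ nonempty
      -- A copy of S avoiding all chosen copies is disjoint from each, hence itself chosen by
      -- maximality; its value at `s₀` then lies in `Copy` after all.
      rest = small (_∉ Copy) λ (e , e∉) →
        e∉ s₀ (e , maximal (λ {e′} e′∈R s s′ eq → e∉ s′ (e′ , e′∈R , s , eq)) , s₀ , refl)
      g : K → S
      g = proj₁ rest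
      locate : K → (S ↣ K) × (S ⊎ S)
      locate x with em {P = Copy x}
      ... | yes (e , _ , s , _) = e , inj₁ s
      ... | no _                = e₀ , inj₂ (g x)
      locate∈R : ∀ x → proj₁ (locate x) ∈ R
      locate∈R x with em {P = Copy x}
      ... | yes (_ , e∈R , _) = e∈R
      ... | no _              = proj₂ nonempty
      locate-inj : ∀ {x y} → locate x ≡ locate y → x ≡ y
      locate-inj {x} {y} eq with em {P = Copy x} | em {P = Copy y}
      locate-inj refl | yes (_ , _ , _ , refl) | yes (_ , _ , _ , refl) = refl
      locate-inj eq   | no x∉ | no y∉ = proj₂ rest x∉ y∉ (inj₂-injective (,-injectiveʳ eq))
      locate-inj eq   | yes _ | no _  = case ,-injectiveʳ eq of λ ()
      locate-inj eq   | no _  | yes _ = case ,-injectiveʳ eq of λ ()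
      -- A point of K is a copy `e` with an element of `S ⊎ S`, the remainder being charged to `e₀`.
      -- One copy has room for `(S ⊎ S) × S`, so merging with s stays inside `e`.
      F : K × S → K
      F (x , s) = let e , u = locate x in e ⟪ merge (u , s) ⟫
      F-inj : ∀ {u v} → F u ≡ F v → u ≡ v
      F-inj {x , s} {y , t} eq with em {P = proj₁ (locate x) ≡ proj₁ (locate y)}
      ... | no e≢  = contradiction eq (disjoint (locate∈R x) (locate∈R y) e≢ _ _)
      ... | yes e≡ = cong₂ _,_ (locate-inj (cong₂ _,_ e≡ (,-injectiveˡ u,s≡))) (,-injectiveʳ u,s≡)
        where
        u,s≡ : (proj₂ (locate x) , s) ≡ (proj₂ (locate y) , t)
        u,s≡ = merge-injective (injective (proj₁ (locate y)) (trans (sym (cong (_⟪ _ ⟫) e≡)) eq))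

  open ω₁ using (T)

  -- Here the copies are injective sequences, and a remainder containing none is finite.
  T×ℕ↣T : (T × ℕ) ↣ T
  T×ℕ↣T = absorb ℕ×ℕ↣ℕ 0 1 (λ ()) (uncountable⇒sequence ω₁.uncountable)
    λ D no-copy → finite⇒countable (by-contradiction λ inf → no-copy (infinite⇒sequence inf))

  -- A pair is recorded by its larger entry, the order of the two, and the number of the smaller one
  -- in the countable segment below the larger.
  T×T↣T : (T × T) ↣ T
  T×T↣T = T×ℕ↣T ↣-∘ mk↣ {to = λ (s , t) → code (≺-cmp s t)}
      (λ {(s , t)} {(s′ , t′)} → code-inj (≺-cmp s t) (≺-cmp s′ t′))
    where
    open ω₁
    e : T → T → ℕ
    e t = proj₁ (countable-segment t)
    code : ∀ {s t} → s ≺ t ⊎ s ≡ t ⊎ t ≺ s → T × ℕ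
    code {s} {t} (inj₁ _)        = t , pair 0 (e t s)
    code {s} {t} (inj₂ (inj₁ _)) = t , pair 1 0
    code {s} {t} (inj₂ (inj₂ _)) = s , pair 2 (e s t)
    tag : ∀ {s t : T} {m n m′ n′} → (s , pair m n) ≡ (t , pair m′ n′) → m ≡ m′ × n ≡ n′
    tag eq = pair-injective (,-injectiveʳ eq)
    code-inj : ∀ {s t s′ t′} (c : s ≺ t ⊎ s ≡ t ⊎ t ≺ s) (c′ : s′ ≺ t′ ⊎ s′ ≡ t′ ⊎ t′ ≺ s′) →
      code c ≡ code c′ → (s , t) ≡ (s′ , t′)
    code-inj (inj₁ s≺t) (inj₁ s′≺t) eq with refl ← ,-injectiveˡ eq =
      cong (_, _) (proj₂ (countable-segment _) s≺t s′≺t (proj₂ (tag eq)))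
    code-inj (inj₂ (inj₁ refl)) (inj₂ (inj₁ refl)) eq with refl ← ,-injectiveˡ eq = refl
    code-inj (inj₂ (inj₂ t≺s)) (inj₂ (inj₂ t′≺s)) eq with refl ← ,-injectiveˡ eq =
      cong (_ ,_) (proj₂ (countable-segment _) t≺s t′≺s (proj₂ (tag eq)))
    code-inj (inj₁ _) (inj₂ (inj₁ _)) eq with () ← proj₁ (tag eq)
    code-inj (inj₁ _) (inj₂ (inj₂ _)) eq with () ← proj₁ (tag eq)
    code-inj (inj₂ (inj₁ _)) (inj₁ _) eq with () ← proj₁ (tag eq)
    code-inj (inj₂ (inj₁ _)) (inj₂ (inj₂ _)) eq with () ← proj₁ (tag eq)
    code-inj (inj₂ (inj₂ _)) (inj₁ _) eq with () ← proj₁ (tag eq)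
    code-inj (inj₂ (inj₂ _)) (inj₂ (inj₁ _)) eq with () ← proj₁ (tag eq)

  -- By `ω₁.minimal`, a remainder without a copy of `T` is countable and so embeds in `T`.
  uncountable-absorbs-T : {K : Set} → ¬ Countable {K} U → (K × T) ↣ K
  uncountable-absorbs-T unc =
    absorb T×T↣T (ℕ↣T ⟪ 0 ⟫) (ℕ↣T ⟪ 1 ⟫) (λ eq → case injective ℕ↣T eq of λ ())
      (proj₁ (ω₁.minimal unc))
      λ D no-copy → let f , f-inj = by-contradiction λ ¬count → no-copy (ω₁.minimal ¬count) in
        ℕ↣T ⟪_⟫ ∘ f , λ x∈D y∈D eq → f-inj x∈D y∈D (injective ℕ↣T eq)
    where
    ℕ↣T : ℕ ↣ T
    ℕ↣T = uncountable⇒sequence ω₁.uncountable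

  -- Splitting families of the Cantor space

  C : Set
  C = ℕ → Bool

  Agree : ℕ → Rel C 0ℓ
  Agree zero    x y = ⊤
  Agree (suc n) x y = Agree n x y × x n ≡ y n

  agree-≡ : ∀ {n k x y} → k ℕ.< n → Agree n x y → x k ≡ y k
  agree-≡ {suc n} {k} k<1+n (agr , eq) with ℕ.m≤n⇒m<n∨m≡n (ℕ.≤-pred k<1+n)
  ... | inj₁ k<n  = agree-≡ k<n agr
  ... | inj₂ refl = eq

  agree : ∀ n {x y} → (∀ k → k ℕ.< n → x k ≡ y k) → Agree n x y
  agree zero    eq = tt
  agree (suc n) eq = agree n (λ k k<n → eq k (ℕ.m<n⇒m<1+n k<n)) , eq n ℕ.≤-refl

  C-Open : Pred (Pred C 0ℓ) 0ℓ
  C-Open V = ∀ {x} → x ∈ V → ∃ λ n → ∀ {y} → Agree n x y → y ∈ V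

  Unbounded : Pred (Pred ℕ 0ℓ) 0ℓ
  Unbounded P = ∀ N → ∃ λ n → N ℕ.≤ n × n ∈ P

  SplitsSeq : {A : Set} → Pred A 0ℓ → (ℕ → A) → Set
  SplitsSeq V s = Unbounded (λ n → s n ∈ V) × Unbounded (λ n → s n ∉ V)

  ¬unbounded : {P : Pred ℕ 0ℓ} → ¬ Unbounded P → ∃ λ N → ∀ {n} → N ℕ.≤ n → n ∉ P
  ¬unbounded ¬unb = let N , ∄ = ¬∀⟶∃¬ ¬unb in N , λ N≤n n∈P → ∄ (_ , N≤n , n∈P)

  splitsSeq-cong : {A : Set} {B : Set} (V : Pred A 0ℓ) (s : ℕ → A) (W : Pred B 0ℓ) (t : ℕ → B) →
    (∀ n → s n ∈ V → t n ∈ W) → (∀ n → t n ∈ W → s n ∈ V) → SplitsSeq V s → SplitsSeq W t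
  splitsSeq-cong V s W t f g (ins , outs) =
    (λ N → let n , N≤n , n∈ = ins N in n , N≤n , f n n∈) ,
    (λ N → let n , N≤n , n∉ = outs N in n , N≤n , n∉ ∘ g n)

  -- Unlike in `SplittingFamily`, members may repeat: preimages of distinct sets may coincide, and
  -- enlarging the index type repeats members.
  record Cover {A : Set} (Open : Pred (Pred A 0ℓ) p) (κ : Set) : Set (Level.suc 0ℓ ⊔ p) where
    field
      member : κ → Pred A 0ℓ
      isOpen : ∀ i → Open (member i)
      splits : ∀ (s : ℕ ↣ A) → ∃ λ i → SplitsSeq (member i) (s ⟪_⟫)
  open Cover

  cover-↣ : {A : Set} {Open : Pred (Pred A 0ℓ) p} {κ μ : Set} → κ → κ ↣ μ →
            Cover Open κ → Cover Open μ
  cover-↣ {κ = κ} {μ} i₀ f c = record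
    { member = member c ∘ back
    ; isOpen = isOpen c ∘ back
    ; splits = λ s → let i , spl = splits c s in
        f ⟪ i ⟫ , subst (λ j → SplitsSeq (member c j) (s ⟪_⟫)) (sym (back-f i)) spl
    }
    where
    back : μ → κ
    back j with em {P = ∃ λ i → f ⟪ i ⟫ ≡ j}
    ... | yes (i , _) = i
    ... | no _        = i₀
    back-f : ∀ i → back (f ⟪ i ⟫) ≡ i
    back-f i with em {P = ∃ λ k → f ⟪ k ⟫ ≡ f ⟪ i ⟫}
    ... | yes (_ , eq) = injective f eq
    ... | no ∄         = contradiction (i , refl) ∄

  increasing : {g : ℕ → ℕ} → (∀ n → g n ℕ.< g (suc n)) → ∀ {m n} → m ℕ.<′ n → g m ℕ.< g n
  increasing g< ℕ.<′-base       = g< _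
  increasing g< (ℕ.≤′-step m<n) = ℕ.<-trans (increasing g< m<n) (g< _)

  expanding : {g : ℕ → ℕ} → (∀ n → g n ℕ.< g (suc n)) → ∀ n → n ℕ.≤ g n
  expanding g< zero    = ℕ.z≤n
  expanding g< (suc n) = ℕ.≤-<-trans (expanding g< n) (g< n)

  -- Infinite index sets `I k` decrease so that `I (suc k)` lies entirely inside or entirely outside
  -- `V k`. An increasing g with `g k` in `I k` is eventually inside each of them.
  unsplit-subsequence : {A : Set} (V : ℕ → Pred A 0ℓ) (s : ℕ ↣ A) →
    ∃ λ (s′ : ℕ ↣ A) → ∀ k → ¬ SplitsSeq (V k) (s′ ⟪_⟫)
  unsplit-subsequence V s =
    s ↣-∘ mk↣ (ordered-injective λ m<n → ℕ.<⇒≢ (increasing g< (ℕ.<⇒<′ m<n))) , unsplit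
    where
    Decided : (W P Q : Pred ℕ 0ℓ) → Set
    Decided W P Q = Q ⊆ P × ((∀ n → n ∈ Q → n ∈ W) ⊎ (∀ n → n ∈ Q → n ∉ W))
    refine : ∀ W → ((P , _) : ∃ Unbounded) → ∃ λ ((Q , _) : ∃ Unbounded) → Decided W P Q
    refine W (P , unb) with em {P = Unbounded (P ∩ W)}
    ... | yes unb′ = (P ∩ W , unb′) , proj₁ , inj₁ λ _ → proj₂
    ... | no ¬unb′ = let N₀ , out = ¬unbounded ¬unb′ in
      (P ∖ W , λ N → let n , N⊔N₀≤n , n∈P = unb (N ℕ.⊔ N₀) in
        n , ℕ.m⊔n≤o⇒m≤o N N₀ N⊔N₀≤n , n∈P , λ n∈W → out (ℕ.m⊔n≤o⇒n≤o N N₀ N⊔N₀≤n) (n∈P , n∈W)) ,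
      proj₁ , inj₂ λ _ → proj₂
    W : ℕ → Pred ℕ 0ℓ
    W k n = s ⟪ n ⟫ ∈ V k
    stage : ℕ → ∃ Unbounded
    stage zero    = U , λ N → N , ℕ.≤-refl , tt
    stage (suc k) = proj₁ (refine (W k) (stage k))
    I : ℕ → Pred ℕ 0ℓ
    I k = proj₁ (stage k)
    I-antitone : ∀ {m n} → m ℕ.≤′ n → I n ⊆ I m
    I-antitone ℕ.≤′-refl                  = id
    I-antitone (ℕ.≤′-step {n = n} m≤n) x∈ =
      I-antitone m≤n (proj₁ (proj₂ (refine (W n) (stage n))) x∈)
    g : ℕ → ℕ
    g zero    = proj₁ (proj₂ (stage 0) 0)
    g (suc k) = proj₁ (proj₂ (stage (suc k)) (suc (g k)))
    g< : ∀ k → g k ℕ.< g (suc k)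
    g< k = proj₁ (proj₂ (proj₂ (stage (suc k)) (suc (g k))))
    g∈I : ∀ k → g k ∈ I k
    g∈I zero    = proj₂ (proj₂ (proj₂ (stage 0) 0))
    g∈I (suc k) = proj₂ (proj₂ (proj₂ (stage (suc k)) (suc (g k))))
    g∈I-late : ∀ {k n} → k ℕ.≤ n → g n ∈ I k
    g∈I-late {n = n} k≤n = I-antitone (ℕ.≤⇒≤′ k≤n) (g∈I n)
    unsplit : ∀ k → ¬ SplitsSeq (V k) (λ n → s ⟪ g n ⟫)
    unsplit k (ins , outs) with proj₂ (proj₂ (refine (W k) (stage k)))
    ... | inj₁ inside  = let n , k<n , n∉ = outs (suc k) in n∉ (inside _ (g∈I-late k<n))
    ... | inj₂ outside = let n , k<n , n∈ = ins (suc k) in outside _ (g∈I-late k<n) n∈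

  cover⇒uncountable : {A : Set} {Open : Pred (Pred A 0ℓ) p} {κ : Set} →
    ℕ ↣ A → Cover Open κ → ¬ Countable {κ} U
  cover⇒uncountable s₀ c (f , f-inj) =
    let s , unsplit = unsplit-subsequence V s₀
        i , spl     = splits c s
    in unsplit (f i) (splitsSeq-cong (member c i) (s ⟪_⟫) (V (f i)) (s ⟪_⟫) (λ _ x∈ → i , refl , x∈)
         (λ _ (j , fj≡fi , x∈) → subst (λ k → _ ∈ member c k) (f-inj tt tt fj≡fi) x∈) spl)
    where
    V = λ n x → ∃ λ i → f i ≡ n × x ∈ member c i

  -- A sequence not split by any basic clopen set converges to some pt, and is
  -- then split by a union of every other annulus around pt among those it visits.
  open-splits : (s : ℕ ↣ C) → ∃ λ V → C-Open V × SplitsSeq V (s ⟪_⟫)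
  open-splits s = by-contradiction λ ∄ →
    ∄ (Unsplit.V ∄ , Unsplit.V-open ∄ , Unsplit.V-in ∄ , Unsplit.V-out ∄)
    where
    module Unsplit (∄ : ¬ ∃ λ V → C-Open V × SplitsSeq V (s ⟪_⟫)) where
      s′ : ℕ → C
      s′ n = s ⟪ n ⟫
      eventually : ∀ k → ∃ λ b → ∃ λ N → ∀ {n} → N ℕ.≤ n → b ≡ s′ n k
      eventually k with em {P = Unbounded λ n → s′ n k ≡ true}
      ... | no ¬unb = let N , out = ¬unbounded ¬unb in
        false , N , λ N≤n → sym (Bool.¬-not (out N≤n))
      ... | yes unb = let N , out = ¬unbounded λ unb′ → ∄ ((λ x → x k ≡ true) ,
                            (λ xk≡true → suc k , λ (_ , eq) → trans (sym eq) xk≡true) , unb , unb′) in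
        true , N , λ N≤n → sym (by-contradiction (out N≤n))
      pt : C
      pt k = proj₁ (eventually k)
      converges : ∀ k → ∃ λ N → ∀ {n} → N ℕ.≤ n → Agree k pt (s′ n)
      converges zero    = 0 , λ _ → tt
      converges (suc k) = let N , agr = converges k ; M , eq = proj₂ (eventually k) in
        N ℕ.⊔ M , λ N⊔M≤n → agr (ℕ.m⊔n≤o⇒m≤o N M N⊔M≤n) , eq (ℕ.m⊔n≤o⇒n≤o N M N⊔M≤n)
      Away : ℕ → ℕ → Set
      Away n k = pt k ≢ s′ n k
      away : ∀ {n} → s′ n ≢ pt → ∃ (Away n)
      away s≢p = ¬∀⟶∃¬ λ eq → s≢p (sym (ext eq))
      away-late : ∀ N → ∃ λ n → N ℕ.≤ n × ∃ (Away n)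
      away-late N with em {P = s′ N ≡ pt}
      ... | no s≢p  = N , ℕ.≤-refl , away s≢p
      ... | yes s≡p = suc N , ℕ.n≤1+n N , away λ s≡p′ →
        ℕ.1+n≢n (injective s (trans s≡p′ (sym s≡p)))
      -- The next term is taken so late that it agrees with `pt` through the current level k; its
      -- own coordinate of difference is therefore higher.
      next : (l : ∃₂ Away) → ∃ λ (l′ : ∃₂ Away) →
        proj₁ l ℕ.< proj₁ l′ × Agree (suc (proj₁ (proj₂ l))) pt (s′ (proj₁ l′))
      next (n , k , _) =
        let N , agr = converges (suc k)
            n′ , N⊔1+n≤n′ , k′ , differ = away-late (N ℕ.⊔ suc n)
        in (n′ , k′ , differ) , ℕ.m⊔n≤o⇒n≤o N (suc n) N⊔1+n≤n′ , agr (ℕ.m⊔n≤o⇒m≤o N (suc n) N⊔1+n≤n′)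
      walk : ℕ → ∃₂ Away
      walk zero    = let n , _ , k , differ = away-late 0 in n , k , differ
      walk (suc j) = proj₁ (next (walk j))
      time level : ℕ → ℕ
      time j  = proj₁ (walk j)
      level j = proj₁ (proj₂ (walk j))
      time< : ∀ j → time j ℕ.< time (suc j)
      time< j = proj₁ (proj₂ (next (walk j)))
      level< : ∀ j → level j ℕ.< level (suc j)
      level< j = ℕ.≰⇒> λ level≥ → proj₂ (proj₂ (walk (suc j)))
        (agree-≡ (ℕ.s≤s level≥) (proj₂ (proj₂ (next (walk j)))))
      Annulus : ℕ → Pred C 0ℓ
      Annulus j x = Agree (suc (level j)) pt x × pt (level (suc j)) ≢ x (level (suc j))
      -- `Annulus j` lies between the levels of steps j and `suc j`, so it is visited at step
      -- `suc j`; hence the shift in `V-in` and `V-out`.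
      visit : ∀ j → s′ (time (suc j)) ∈ Annulus j
      visit j = proj₂ (proj₂ (next (walk j))) , proj₂ (proj₂ (walk (suc j)))
      annuli-disjoint : ∀ {i j x} → i ℕ.< j → x ∈ Annulus i → x ∉ Annulus j
      annuli-disjoint {i} {j} i<j (_ , differ) (agr , _) = differ (agree-≡ (ℕ.s≤s (level≤ (ℕ.≤⇒≤′ i<j))) agr)
        where
        level≤ : ∀ {i j} → i ℕ.≤′ j → level i ℕ.≤ level j
        level≤ ℕ.≤′-refl       = ℕ.≤-refl
        level≤ (ℕ.≤′-step {n = j} i≤j) = ℕ.≤-trans (level≤ i≤j) (ℕ.<⇒≤ (level< j))
      V : Pred C 0ℓ
      V x = ∃ λ i → x ∈ Annulus (i ℕ.+ i)
      V-open : C-Open V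
      V-open {x} (i , agr , differ) = suc (level (suc (i ℕ.+ i))) , λ x~y → i ,
        agree _ (λ k k< → trans (agree-≡ k< agr)
          (agree-≡ (ℕ.<-trans k< (ℕ.s≤s (level< (i ℕ.+ i)))) x~y)) ,
        λ eq → differ (trans eq (sym (proj₂ x~y)))
      late : ∀ N j → N ℕ.≤ j → N ℕ.≤ time (suc j)
      late N j N≤j = ℕ.≤-trans (ℕ.m≤n⇒m≤1+n N≤j) (expanding time< (suc j))
      V-in : Unbounded λ n → s′ n ∈ V
      V-in N = time (suc (N ℕ.+ N)) , late N (N ℕ.+ N) (ℕ.m≤m+n N N) , N , visit (N ℕ.+ N)
      odd≢even : ∀ i j → suc (i ℕ.+ i) ≢ j ℕ.+ j
      odd≢even i (suc j) eq = even≢odd j i (sym (trans (ℕ.suc-injective eq) (ℕ.+-suc j j)))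
        where
        even≢odd : ∀ j i → suc (j ℕ.+ j) ≢ i ℕ.+ i
        even≢odd j i = odd≢even j i
      V-out : Unbounded λ n → s′ n ∉ V
      V-out N = time (suc m) , late N m (ℕ.m≤n⇒m≤1+n (ℕ.m≤m+n N N)) , outside
        where
        m = suc (N ℕ.+ N)
        outside : s′ (time (suc m)) ∉ V
        outside (i , ∈i) with ℕ.<-cmp (i ℕ.+ i) m
        ... | tri< i<m _ _ = annuli-disjoint i<m ∈i (visit m)
        ... | tri≈ _ i≡m _ = odd≢even N i (sym i≡m)
        ... | tri> _ _ m<i = annuli-disjoint m<i (visit m) ∈i

  -- Hönig: take a maximal set of choice functions differing in every coordinate;
  -- some coordinate exhausts its factor.
  least-cardinal : {I : Set} (F : I → Set) → I → ∃ λ i → ∀ j → F i ↣ F j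
  least-cardinal {I} F i₀ = i , λ j → mk↣ {to = λ x → proj₁ (hit x) j} λ {x} {y} eq →
    trans (sym (proj₂ (proj₂ (hit x)))) (trans (cong (λ f → f i) (same x y j eq)) (proj₂ (proj₂ (hit y))))
    where
    family = maximal-clique (λ (f g : ∀ i → F i) → ∀ i → f i ≢ g i) (λ f~g i eq → f~g i (sym eq))
    R = proj₁ family
    exhausted : ∃ λ i → ∀ x → ∃ λ f → f ∈ R × f i ≡ x
    exhausted = by-contradiction λ ∄ →
      -- A choice function through missed values differs from all of `R` in every coordinate, so
      -- maximality puts it in `R`, although its value at `i₀` is missed.
      let missed : ∀ i → ∃ λ x → ¬ ∃ λ f → f ∈ R × f i ≡ x
          missed i = ¬∀⟶∃¬ λ all → ∄ (i , all)
          g∈R = proj₂ (proj₂ family) {proj₁ ∘ missed} λ {f} f∈R i eq → proj₂ (missed i) (f , f∈R , eq)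
      in proj₂ (missed i₀) (_ , g∈R , refl)
    i = proj₁ exhausted
    hit : ∀ x → ∃ λ f → f ∈ R × f i ≡ x
    hit = proj₂ exhausted
    same : ∀ x y j → proj₁ (hit x) j ≡ proj₁ (hit y) j → proj₁ (hit x) ≡ proj₁ (hit y)
    same x y j eq = by-contradiction λ differ →
      proj₁ (proj₂ family) (proj₁ (proj₂ (hit x))) (proj₁ (proj₂ (hit y))) differ j eq

  -- Families of subsets of C are coded in `(C → Bool) → Bool`, so the covering ones form a `Set`
  -- and `least-cardinal` applies. An arbitrary cover maps onto the family of its members, and a
  -- section of that map is `subfamily-↣`.
  least-cover : ∃ λ κ → Cover C-Open κ × (∀ μ → Cover C-Open μ → κ ↣ μ)
  least-cover = let i , F↣ = least-cardinal F all in
    F i , toCover i , λ μ c → subfamily-↣ c ↣-∘ F↣ (subfamily c)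
    where
    ⌈_⌉ : (C → Bool) → Pred C 0ℓ
    ⌈ P ⌉ x = P x ≡ true
    Covering : Pred ((C → Bool) → Bool) 0ℓ
    Covering S = (∀ P → S P ≡ true → C-Open ⌈ P ⌉) ×
      (∀ (s : ℕ ↣ C) → ∃ λ P → S P ≡ true × SplitsSeq ⌈ P ⌉ (s ⟪_⟫))
    F : (∃ λ S → χ Covering S ≡ true) → Set
    F (S , _) = ∃ λ P → S P ≡ true
    toCover : ∀ i → Cover C-Open (F i)
    toCover (S , cov) = record
      { member = ⌈_⌉ ∘ proj₁
      ; isOpen = λ (P , P∈S) → proj₁ (χ⁻ Covering cov) P P∈S
      ; splits = λ s → let P , P∈S , spl = proj₂ (χ⁻ Covering cov) s in (P , P∈S) , spl
      }
    χ-open : ∀ {V} → C-Open V → C-Open ⌈ χ V ⌉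
    χ-open {V} V-open x∈ = let n , near = V-open (χ⁻ V x∈) in n , λ agr → χ⁺ V (near agr)
    χ-splits : ∀ V s → SplitsSeq V s → SplitsSeq ⌈ χ V ⌉ s
    χ-splits V s = splitsSeq-cong V s ⌈ χ V ⌉ s (λ _ → χ⁺ V) (λ _ → χ⁻ V)
    all : ∃ λ S → χ Covering S ≡ true
    all = χ (C-Open ∘ ⌈_⌉) , χ⁺ Covering ((λ P → χ⁻ (C-Open ∘ ⌈_⌉)) ,
      λ s → let V , V-open , spl = open-splits s in
        χ V , χ⁺ (C-Open ∘ ⌈_⌉) (χ-open V-open) , χ-splits V (s ⟪_⟫) spl)
    module _ {μ : Set} (c : Cover C-Open μ) where
      Member : Pred (C → Bool) 0ℓ
      Member P = ∃ λ i → χ (member c i) ≡ P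
      subfamily : ∃ λ S → χ Covering S ≡ true
      subfamily = χ Member , χ⁺ Covering
        ((λ P P∈ → let i , eq = χ⁻ Member P∈ in subst (C-Open ∘ ⌈_⌉) eq (χ-open (isOpen c i))) ,
         λ s → let i , spl = splits c s in χ (member c i) , χ⁺ Member (i , refl) , χ-splits (member c i) (s ⟪_⟫) spl)
      subfamily-↣ : F subfamily ↣ μ
      subfamily-↣ = mk↣ {to = λ (P , P∈) → proj₁ (χ⁻ Member P∈)} λ {(P , P∈)} {(Q , Q∈)} eq →
        Σ≡ P∈ Q∈ (trans (sym (proj₂ (χ⁻ Member P∈)))
          (trans (cong (χ ∘ member c) eq) (proj₂ (χ⁻ Member Q∈))))
        where
        Σ≡ : ∀ {P Q} (P∈ : χ Member P ≡ true) (Q∈ : χ Member Q ≡ true) → P ≡ Q → (P , P∈) ≡ (Q , Q∈)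
        Σ≡ P∈ Q∈ refl = cong (_ ,_) (≡-irrelevant P∈ Q∈)

  -- Covers and splitting families

  avoids : {A : Set} (s : ℕ ↣ A) (xs : List A) → ∃ λ N → ∀ {n} → N ℕ.≤ n → s ⟪ n ⟫ ∉ˡ xs
  avoids s [] = 0 , λ _ ()
  avoids s (x ∷ xs) with avoids s xs | em {P = ∃ λ m → s ⟪ m ⟫ ≡ x}
  ... | N , avoid | no ∄ = N , λ where
    N≤n (here eq)  → ∄ (_ , eq)
    N≤n (there ∈xs) → avoid N≤n ∈xs
  ... | N , avoid | yes (m , sm≡x) = N ℕ.⊔ suc m , λ where
    ≤n (here eq)   → ℕ.<⇒≢ (ℕ.m⊔n≤o⇒n≤o N (suc m) ≤n) (injective s (trans sm≡x (sym eq)))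
    ≤n (there ∈xs) → avoid (ℕ.m⊔n≤o⇒m≤o N (suc m) ≤n) ∈xs

  unbounded⇒infinite : {A : Set} {P : Pred A 0ℓ} (s : ℕ ↣ A) →
    Unbounded (λ n → s ⟪ n ⟫ ∈ P) → Infinite P
  unbounded⇒infinite s unb (xs , P⊆xs) =
    let N , avoid = avoids s xs ; n , N≤n , sn∈P = unb N in avoid N≤n (P⊆xs sn∈P)

  Range : {A : Set} → ℕ ↣ A → Pred A 0ℓ
  Range s x = ∃ λ n → s ⟪ n ⟫ ≡ x

  infinite⇒unbounded : {A : Set} {P : Pred A 0ℓ} (s : ℕ ↣ A) →
    Infinite (Range s ∩ P) → Unbounded (λ n → s ⟪ n ⟫ ∈ P)
  infinite⇒unbounded {P = P} s inf N = by-contradiction λ ∄ →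
    inf (List.map (s ⟪_⟫) (List.upTo N) , λ where
      ((n , refl) , sn∈P) → List.∈-map⁺ (s ⟪_⟫) (List.∈-upTo⁺ (ℕ.≰⇒> λ N≤n → ∄ (n , N≤n , sn∈P))))

  splittingFamily⇒cover : {X : Space} {κ : Set} → SplittingFamily X κ → Cover (Space.Open X) κ
  splittingFamily⇒cover {X} {κ} F = record
    { member = F.member
    ; isOpen = F.isOpen
    ; splits = λ s → let i , ins , outs = F.splits (Range s) (unbounded⇒infinite s λ N →
                                            N , ℕ.≤-refl , N , refl) in
        i , infinite⇒unbounded s ins , infinite⇒unbounded s outs
    }
    where module F = SplittingFamily F

  data OrbitOutside {K : Set} (P : Pred K 0ℓ) (f : K → K) : Pred K 0ℓ where
    base : ∀ {x} → x ∉ P → OrbitOutside P f x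
    step : ∀ {x} → OrbitOutside P f x → OrbitOutside P f (f x)

  -- The Cantor-Bernstein bijection of K with a subset P: h is f along the orbits that start outside
  -- P, and the identity elsewhere.
  schröder-bernstein : {K : Set} (P : Pred K 0ℓ) (f : K ↣ K) → (∀ x → f ⟪ x ⟫ ∈ P) →
    ∃ λ (h : K ↣ K) → (∀ x → h ⟪ x ⟫ ∈ P) × (∀ {y} → y ∈ P → ∃ λ x → h ⟪ x ⟫ ≡ y)
  schröder-bernstein {K} P f f∈P = mk↣ {to = h} h-inj , h∈P , h-surj
    where
    Orbit = OrbitOutside P (f ⟪_⟫)
    h : K → K
    h x with em {P = Orbit x}
    ... | yes _ = f ⟪ x ⟫
    ... | no _  = x
    h-inj : ∀ {x y} → h x ≡ h y → x ≡ y
    h-inj {x} {y} eq with em {P = Orbit x} | em {P = Orbit y}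
    ... | yes _  | yes _  = injective f eq
    ... | no _   | no _   = eq
    ... | yes ox | no ¬oy = contradiction (subst Orbit eq (step ox)) ¬oy
    ... | no ¬ox | yes oy = contradiction (subst Orbit (sym eq) (step oy)) ¬ox
    h∈P : ∀ x → h x ∈ P
    h∈P x with em {P = Orbit x}
    ... | yes _ = f∈P x
    ... | no ¬o = by-contradiction λ x∉P → ¬o (base x∉P)
    h-orbit : ∀ {x} → Orbit x → h x ≡ f ⟪ x ⟫
    h-orbit {x} o with em {P = Orbit x}
    ... | yes _ = refl
    ... | no ¬o = contradiction o ¬o
    h-surj : ∀ {y} → y ∈ P → ∃ λ x → h x ≡ y
    h-surj {y} y∈P with em {P = Orbit y} in eq
    ... | yes (base y∉P) = contradiction y∈P y∉P
    ... | yes (step {x} o) = x , h-orbit o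
    ... | no _ = y , fixed
      where
      fixed : h y ≡ y
      fixed rewrite eq = refl

  χ-⊆ : {A : Set} {P Q : Pred A 0ℓ} → χ P ≡ χ Q → P ⊆ Q
  χ-⊆ {P = P} {Q} eq {x} x∈P = χ⁻ Q (trans (cong (λ V → V x) (sym eq)) (χ⁺ P x∈P))

  splitsSeq⇒splits : {A : Set} {P V : Pred A 0ℓ} (s : ℕ ↣ A) → (∀ n → s ⟪ n ⟫ ∈ P) →
    SplitsSeq V (s ⟪_⟫) → V Splits P
  splitsSeq⇒splits s s∈P (ins , outs) =
    unbounded⇒infinite s (λ N → let n , N≤n , ∈V = ins N in n , N≤n , s∈P n , ∈V) ,
    unbounded⇒infinite s (λ N → let n , N≤n , ∉V = outs N in n , N≤n , s∈P n , ∉V)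

  -- Keep one index per member. Minimality embeds κ into the kept indices, so Cantor-Bernstein makes
  -- them equipotent with κ, and κ itself enumerates the family without repetition.
  least-cover⇒splittingFamily : {X : Space} {κ : Set} → κ → Cover (Space.Open X) κ →
    (∀ μ → Cover (Space.Open X) μ → κ ↣ μ) → SplittingFamily X κ
  least-cover⇒splittingFamily {X} {κ} i₀ c least = record
    { member   = member c ∘ (h ⟪_⟫)
    ; distinct = λ {i} {j} m≐m → injective h (trans (sym (h∈Canonical i))
        (trans (cong rep (χ-cong (proj₁ m≐m) (proj₂ m≐m))) (h∈Canonical j)))
    ; isOpen   = isOpen c ∘ (h ⟪_⟫)
    ; splits   = λ A inf →
        let s , s∈A = infinite⇒sequence inf
            i , spl = splits c s
            j , hj≡ = h-surj (rep-canonical i)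
        in j , splitsSeq⇒splits s s∈A
                 (subst (λ k → SplitsSeq (member c k) (s ⟪_⟫)) (sym hj≡) (rep-splits s i spl))
    }
    where
    rep : (Space.Carrier X → Bool) → κ
    rep V with em {P = ∃ λ i → χ (member c i) ≡ V}
    ... | yes (i , _) = i
    ... | no _        = i₀
    rep-≡ : ∀ i → χ (member c (rep (χ (member c i)))) ≡ χ (member c i)
    rep-≡ i with em {P = ∃ λ j → χ (member c j) ≡ χ (member c i)}
    ... | yes (_ , eq) = eq
    ... | no ∄         = contradiction (i , refl) ∄
    rep-splits : ∀ (s : ℕ ↣ Space.Carrier X) i → SplitsSeq (member c i) (s ⟪_⟫) →
      SplitsSeq (member c (rep (χ (member c i)))) (s ⟪_⟫)
    rep-splits s i = splitsSeq-cong (member c i) (s ⟪_⟫) (member c (rep (χ (member c i)))) (s ⟪_⟫)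
      (λ _ → χ-⊆ (sym (rep-≡ i))) (λ _ → χ-⊆ (rep-≡ i))
    Canonical : Pred κ 0ℓ
    Canonical i = rep (χ (member c i)) ≡ i
    rep-canonical : ∀ i → rep (χ (member c i)) ∈ Canonical
    rep-canonical i = cong rep (rep-≡ i)
    canonical : Cover (Space.Open X) (∃ Canonical)
    canonical = record
      { member = member c ∘ proj₁
      ; isOpen = isOpen c ∘ proj₁
      ; splits = λ s → let i , spl = splits c s in (_ , rep-canonical i) , rep-splits s i spl
      }
    ∃Canonical↣κ : ∃ Canonical ↣ κ
    ∃Canonical↣κ = mk↣ {to = proj₁} λ {(_ , p)} {(_ , q)} eq → Σ≡ p q eq
      where
      Σ≡ : ∀ {x y} (p : Canonical x) (q : Canonical y) → x ≡ y → (x , p) ≡ (y , q)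
      Σ≡ p q refl = cong (_ ,_) (≡-irrelevant p q)
    κ↣∃Canonical = least _ canonical
    bernstein = schröder-bernstein Canonical (∃Canonical↣κ ↣-∘ κ↣∃Canonical)
                  (λ x → proj₂ (κ↣∃Canonical ⟪ x ⟫))
    h : κ ↣ κ
    h = proj₁ bernstein
    h∈Canonical : ∀ x → h ⟪ x ⟫ ∈ Canonical
    h∈Canonical = proj₁ (proj₂ bernstein)
    h-surj : ∀ {i} → i ∈ Canonical → ∃ λ j → h ⟪ j ⟫ ≡ i
    h-surj = proj₂ (proj₂ bernstein)

  -- Rationals and metrics

  gap : ∀ {p q} → p ℚ.< q → ∃ λ δ → 0ℚ ℚ.< δ × p ℚ.+ δ ≡ q
  gap {p} {q} p<q = q ℚ.- p , subst (ℚ._< q ℚ.- p) (ℚ.+-inverseʳ p) (ℚ.+-monoˡ-< (ℚ.- p) p<q) , (begin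
    p ℚ.+ (q ℚ.- p)        ≡⟨ cong (p ℚ.+_) (ℚ.+-comm q (ℚ.- p)) ⟩
    p ℚ.+ (ℚ.- p ℚ.+ q)    ≡⟨ ℚ.+-assoc p (ℚ.- p) q ⟨
    (p ℚ.- p) ℚ.+ q        ≡⟨ cong (ℚ._+ q) (ℚ.+-inverseʳ p) ⟩
    0ℚ ℚ.+ q               ≡⟨ ℚ.+-identityˡ q ⟩
    q                      ∎)
    where open ≡-Reasoning

  half : ∀ {ε} → 0ℚ ℚ.< ε → ∃ λ η → 0ℚ ℚ.< η × η ℚ.+ η ≡ ε
  half {ε} 0<ε = ε ℚ.* ℚ.½ , subst (ℚ._< ε ℚ.* ℚ.½) (ℚ.*-zeroˡ ℚ.½) (ℚ.*-monoˡ-<-pos ℚ.½ 0<ε) ,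
    trans (sym (ℚ.*-distribˡ-+ ε ℚ.½ ℚ.½)) (ℚ.*-identityʳ ε)

  q<q+q : ∀ {q} → 0ℚ ℚ.< q → q ℚ.< q ℚ.+ q
  q<q+q {q} 0<q = subst (ℚ._< q ℚ.+ q) (ℚ.+-identityʳ q) (ℚ.+-monoʳ-< q 0<q)

  abstract
    -- This is 1/(n+1), as `mkℚ` stores the denominator minus one.
    δ : ℕ → ℚ
    δ n = mkℚ (ℤ.+ 1) n (1-coprimeTo (suc n))

    δ>0 : ∀ n → 0ℚ ℚ.< δ n
    δ>0 n = ℚ.positive⁻¹ (δ n)

    δ-small : ∀ {ε} → 0ℚ ℚ.< ε → ∃ λ n → δ n ℚ.≤ ε
    δ-small {mkℚ (ℤ.+ suc a) d _} _ = d , ℚ.*≤* (ℤ.*-monoʳ-≤-nonNeg (ℤ.+ suc d) (ℤ.+≤+ (ℕ.s≤s (ℕ.z≤n {a}))))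
    δ-small {mkℚ (ℤ.+ zero) d _} (ℚ.*<* 0<0) = ⊥-elim (ℤ.<-irrefl refl 0<0)
    δ-small {mkℚ ℤ.-[1+ n ] d _} (ℚ.*<* ())

  quadruple : ℚ → ℚ
  quadruple q = (q ℚ.+ q) ℚ.+ (q ℚ.+ q)

  quarter : ∀ {ε} → 0ℚ ℚ.< ε → ∃ λ η → 0ℚ ℚ.< η × quadruple η ≡ ε
  quarter 0<ε = let η , 0<η , η+η≡ε = half 0<ε ; ζ , 0<ζ , ζ+ζ≡η = half 0<η in
    ζ , 0<ζ , trans (cong₂ ℚ._+_ ζ+ζ≡η ζ+ζ≡η) η+η≡ε

  quadruple-mono : ∀ {p q} → p ℚ.≤ q → quadruple p ℚ.≤ quadruple q
  quadruple-mono p≤q = ℚ.+-mono-≤ (ℚ.+-mono-≤ p≤q p≤q) (ℚ.+-mono-≤ p≤q p≤q)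

  δ-quarter : ∀ {ε} → 0ℚ ℚ.< ε → ∃ λ n → quadruple (δ n) ℚ.≤ ε
  δ-quarter 0<ε = let η , 0<η , 4η≡ε = quarter 0<ε ; n , δ≤η = δ-small 0<η in
    n , subst (quadruple (δ n) ℚ.≤_) 4η≡ε (quadruple-mono δ≤η)

  -- A real in the half-open interval (p, q], coded by the characteristic function of its lower cut.
  -- Such codes live in a `Set`, unlike `ℝ`, and equal reals have equal codes.
  record IsCut (p q : ℚ) (r : ℚ → Bool) : Set where
    field
      low    : r p ≡ true
      high   : r q ≡ false
      down   : ∀ {u v} → u ℚ.< v → r v ≡ true → r u ≡ true
      open′  : ∀ {u} → r u ≡ true → ∃ λ v → u ℚ.< v × r v ≡ true

  module _ {p q : ℚ} (p<q : p ℚ.< q) where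

    record Interval : Set where
      constructor interval
      field
        {lo hi} : ℚ
        lo<hi   : lo ℚ.< hi
    open Interval

    -- An intermediate rational m tells on which side of it r lies, and J is taken on the other. The
    -- left end moves strictly in both cases, so that the supremum of the left ends exceeds each of
    -- them.
    exclude : (r : ℚ → Bool) (I : Interval) → ∃ λ J →
      lo I ℚ.< lo J × hi J ℚ.≤ hi I × (r (hi J) ≡ true ⊎ r (lo J) ≡ false)
    exclude r I with ℚ.<-dense (lo<hi I)
    ... | m , lo<m , m<hi with r m in eq | ℚ.<-dense lo<m
    ...   | true  | l , lo<l , l<m = interval l<m , lo<l , ℚ.<⇒≤ m<hi , inj₁ eq
    ...   | false | _              = interval m<hi , lo<m , ℚ.≤-refl , inj₂ eq

    -- Diagonalisation by nested intervals: step n excludes the cut numbered n, if there is one,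
    -- while the supremum of the left ends stays in every interval.
    cuts-uncountable : ¬ Countable (IsCut p q)
    cuts-uncountable (f , f-inj) = excluded
      where
      Value : ℕ → Pred (ℚ → Bool) 0ℓ
      Value n r = IsCut p q r × f r ≡ n
      value : ℕ → ℚ → Bool
      value n with em {P = ∃ (Value n)}
      ... | yes (r , _) = r
      ... | no _        = λ _ → false
      nest : ℕ → Interval
      nest zero    = interval p<q
      nest (suc n) = proj₁ (exclude (value n) (nest n))
      lo< : ∀ n → lo (nest n) ℚ.< lo (nest (suc n))
      lo< n = proj₁ (proj₂ (exclude (value n) (nest n)))
      lo-mono : ∀ {m n} → m ℕ.≤′ n → lo (nest m) ℚ.≤ lo (nest n)
      lo-mono ℕ.≤′-refl               = ℚ.≤-refl
      lo-mono (ℕ.≤′-step {n = n} m≤n) = ℚ.≤-trans (lo-mono m≤n) (ℚ.<⇒≤ (lo< n))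
      hi-anti : ∀ {m n} → m ℕ.≤′ n → hi (nest n) ℚ.≤ hi (nest m)
      hi-anti ℕ.≤′-refl               = ℚ.≤-refl
      hi-anti (ℕ.≤′-step {n = n} m≤n) =
        ℚ.≤-trans (proj₁ (proj₂ (proj₂ (exclude (value n) (nest n))))) (hi-anti m≤n)
      lo<hi′ : ∀ m n → lo (nest m) ℚ.< hi (nest n)
      lo<hi′ m n = ℚ.≤-<-trans (lo-mono (ℕ.≤⇒≤′ (ℕ.m≤m⊔n m n)))
        (ℚ.<-≤-trans (lo<hi (nest (m ℕ.⊔ n))) (hi-anti (ℕ.≤⇒≤′ (ℕ.m≤n⊔m m n))))
      Below : Pred ℚ 0ℓ
      Below u = ∃ λ n → u ℚ.< lo (nest n)
      limit : ℚ → Bool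
      limit = χ Below
      limit-lo : ∀ n → limit (lo (nest n)) ≡ true
      limit-lo n = χ⁺ Below (suc n , lo< n)
      limit-hi : ∀ n → limit (hi (nest n)) ≡ false
      limit-hi n = χ⁺-false Below λ (m , hi<lo) → ℚ.<-asym hi<lo (lo<hi′ m n)
      limit-cut : IsCut p q limit
      limit-cut = record
        { low   = limit-lo 0
        ; high  = limit-hi 0
        ; down  = λ u<v v∈ → let n , v<lo = χ⁻ Below v∈ in χ⁺ Below (n , ℚ.<-trans u<v v<lo)
        ; open′ = λ u∈ → let n , u<lo = χ⁻ Below u∈ in lo (nest n) , u<lo , limit-lo n
        }
      value-limit : value (f limit) ≡ limit
      value-limit with em {P = ∃ (Value (f limit))}
      ... | yes (r , r-cut , eq) = f-inj r-cut limit-cut eq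
      ... | no ∄ = contradiction (limit , limit-cut , refl) ∄
      excluded : ⊥
      excluded with proj₂ (proj₂ (proj₂ (exclude (value (f limit)) (nest (f limit)))))
      ... | inj₁ hi∈ = case trans (sym hi∈) (trans (cong (λ r → r (hi (nest (suc (f limit))))) value-limit)
                                                   (limit-hi (suc (f limit)))) of λ ()
      ... | inj₂ lo∉ = case trans (sym lo∉) (trans (cong (λ r → r (lo (nest (suc (f limit))))) value-limit)
                                                   (limit-lo (suc (f limit)))) of λ ()

  -- near x y q stands for d x y ≤ q.
  record RationalMetric (X : Space) : Set₁ where
    open Space X
    field
      near       : Carrier → Carrier → ℚ → Set
      near-sym   : ∀ {x y q} → near x y q → near y x q
      near-tri   : ∀ {x y z p q} → near x y p → near y z q → near x z (p ℚ.+ q)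
      near-mono  : ∀ {x y p q} → p ℚ.≤ q → near x y p → near x y q
      far-open   : ∀ {x y q} → ¬ near x y q → ∃ λ r → q ℚ.< r × ¬ near x y r
      near-refl  : ∀ {x q} → 0ℚ ℚ.< q → near x x q
      separated  : ∀ {x y} → x ≢ y → ∃ λ ε → 0ℚ ℚ.< ε × ¬ near x y ε
      open⇒ball  : ∀ {V x} → Open V → x ∈ V → ∃ λ ε → 0ℚ ℚ.< ε × (∀ {y} → near x y ε → y ∈ V)
      balls⇒open : ∀ {V} → (∀ {x} → x ∈ V → ∃ λ ε → 0ℚ ℚ.< ε × (∀ {y} → near x y ε → y ∈ V)) → Open V
      complete   : (s : ℕ → Carrier) →
        (∀ ε → 0ℚ ℚ.< ε → ∃ λ N → ∀ m n → N ℕ.≤ m → N ℕ.≤ n → near (s m) (s n) ε) →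
        ∃ λ x → ∀ ε → 0ℚ ℚ.< ε → ∃ λ N → ∀ n → N ℕ.≤ n → near (s n) x ε

  module _ {X : Space} where
    open Space X

    rational-metric : CompletelyMetrizable X → RationalMetric X
    rational-metric (d , isMetric , d-complete , open⇔) = record
      { near       = near
      ; near-sym   = λ {x} {y} q∉ q∈ → q∉ (proj₂ (d-sym x y) q∈)
      ; near-tri   = near-tri
      ; near-mono  = near-mono
      ; far-open   = λ {x} {y} far → let r , q<r , r∈ = open′ (d x y) (by-contradiction far) in
                       r , q<r , λ r∉ → r∉ r∈
      ; near-refl  = λ {x} 0<q q∈ → ℚ.<-asym 0<q (proj₁ (≈⇒0 refl) q∈)
      ; separated  = λ {x} {y} x≢y → by-contradiction λ ∄ →
          x≢y (0⇒≈ ((λ {q} q∈ → ℚ.≰⇒> λ 0≤q → let r , q<r , r∈ = open′ (d x y) q∈ in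
            ∄ (r , ℚ.≤-<-trans 0≤q q<r , λ r∉ → r∉ r∈)) , nonNegative))
      ; open⇒ball  = λ V-open x∈V → let ε , 0<ε , ball = Equivalence.to (open⇔ _) V-open x∈V
                                        q , 0<q , q∈ε = positive-below ε 0<ε in
                       q , 0<q , λ near-q → ball (q , near-q , q∈ε)
      ; balls⇒open = λ balls → Equivalence.from (open⇔ _) λ x∈V → let ε , 0<ε , ball = balls x∈V in
                       cut ε , cut-positive 0<ε , λ {y} → ball ∘ <cut⇒near
      ; complete   = λ s cauchy →
          let x , converges = d-complete s λ ε 0<ε →
                let q , 0<q , q∈ε = positive-below ε 0<ε
                    N , close = cauchy q 0<q
                in N , λ m n N≤m N≤n → q , close m n N≤m N≤n , q∈ε
          in x , λ ε 0<ε → let N , close = converges (cut ε) (cut-positive 0<ε) in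
               N , λ n N≤n → <cut⇒near (close n N≤n)
      }
      where
      open IsGeneralMetric isMetric using (≈⇒0; 0⇒≈; nonNegative; triangle) renaming (sym to d-sym)
      open ℝ using (Lower; closed; open′)
      near : Carrier → Carrier → ℚ → Set
      near x y q = q ∉ Lower (d x y)
      below : ∀ z {u v} → u ∈ Lower z → v ∉ Lower z → u ℚ.< v
      below z u∈ v∉ = ℚ.≰⇒> λ v≤u → v∉ (let w , u<w , w∈ = open′ z u∈ in
        closed z (ℚ.≤-<-trans v≤u u<w) w∈)
      near-mono : ∀ {x y p q} → p ℚ.≤ q → near x y p → near x y q
      near-mono {x} {y} p≤q p∉ q∈ = ℚ.<-irrefl refl (ℚ.<-≤-trans (below (d x y) q∈ p∉) p≤q)
      near-tri : ∀ {x y z p q} → near x y p → near y z q → near x z (p ℚ.+ q)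
      near-tri {x} {y} {z} p∉ q∉ p+q∈ = let u , v , u∈ , v∈ , eq = triangle x y z p+q∈ in
        ℚ.<-irrefl (sym eq) (ℚ.+-mono-< (below (d x y) u∈ p∉) (below (d y z) v∈ q∉))
      cut : ℚ → ℝ
      cut q = record
        { Lower     = ℚ._< q
        ; inhabited = q ℚ.- 1ℚ , subst (q ℚ.- 1ℚ ℚ.<_) (ℚ.+-identityʳ q)
                        (ℚ.+-monoʳ-< q (ℚ.neg-antimono-< (ℚ.positive⁻¹ 1ℚ)))
        ; bounded   = q , ℚ.<-irrefl refl
        ; closed    = ℚ.<-trans
        ; open′     = ℚ.<-dense
        }
      cut-positive : ∀ {ε} → 0ℚ ℚ.< ε → 0ℝ < cut ε
      cut-positive 0<ε = 0ℚ , ℚ.<-irrefl refl , 0<ε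
      <cut⇒near : ∀ {x y ε} → d x y < cut ε → near x y ε
      <cut⇒near (w , w∉ , w<ε) = near-mono (ℚ.<⇒≤ w<ε) w∉
      positive-below : ∀ ε → 0ℝ < ε → ∃ λ q → 0ℚ ℚ.< q × q ∈ Lower ε
      positive-below ε (q , q≮0 , q∈ε) = let r , q<r , r∈ε = open′ ε q∈ε in
        r , ℚ.≤-<-trans (ℚ.≮⇒≥ q≮0) q<r , r∈ε

    module _ (M : RationalMetric X) where
      open RationalMetric M

      DenseSequence : (ℕ → Carrier) → Set
      DenseSequence c = ∀ x {ε} → 0ℚ ℚ.< ε → ∃ λ n → near x (c n) ε

      dense-sequence : Separable X → Carrier → ∃ DenseSequence
      dense-sequence (D , (f , f-inj) , dense) x₀ = c , c-dense
        where
        c : ℕ → Carrier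
        c n with em {P = ∃ λ x → x ∈ D × f x ≡ n}
        ... | yes (x , _) = x
        ... | no _        = x₀
        c-f : ∀ {x} → x ∈ D → c (f x) ≡ x
        c-f {x} x∈D with em {P = ∃ λ y → y ∈ D × f y ≡ f x}
        ... | yes (y , y∈D , eq) = f-inj y∈D x∈D eq
        ... | no ∄               = contradiction (x , x∈D , refl) ∄
        Ball : Carrier → ℚ → Pred Carrier 0ℓ
        Ball x ε y = ∃ λ q → q ℚ.< ε × near x y q
        ball-open : ∀ x ε → Open (Ball x ε)
        ball-open x ε = balls⇒open λ (q , q<ε , near-q) →
          let r , q<r , r<ε = ℚ.<-dense q<ε
              η , 0<η , q+η≡r = gap q<r
          in η , 0<η , λ near-η → r , r<ε , subst (near x _) q+η≡r (near-tri near-q near-η)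
        c-dense : DenseSequence c
        c-dense x {ε} 0<ε =
          let r , 0<r , r<ε = ℚ.<-dense 0<ε
              y , (q , q<ε , near-q) , y∈D = dense (Ball x ε) (ball-open x ε) (x , r , r<ε , near-refl 0<r)
          in f y , subst (λ z → near x z ε) (sym (c-f y∈D)) (near-mono (ℚ.<⇒≤ q<ε) near-q)

  -- The Cantor scheme

  module CantorScheme {X : Space} (M : RationalMetric X) where
    open Space X
    open RationalMetric M

    module _ {c : ℕ → Carrier} (c-dense : DenseSequence M c) where

      Condensation : Pred Carrier 0ℓ → Pred Carrier 0ℓ
      Condensation S x = ∀ ε → 0ℚ ℚ.< ε → ¬ Countable (S ∩ λ y → near x y ε)

      -- A Lindelöf argument: each such point lies in a ball of radius `δ j` around some `c i` that
      -- meets S in a countable set, and there are countably many such balls.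
      countable-noncondensation : ∀ S → Countable (S ∖ Condensation S)
      countable-noncondensation S = countable-⋃ Sparse ℕ×ℕ↣ℕ sparse-countable locate
        where
        Patch : ℕ × ℕ → Pred Carrier 0ℓ
        Patch (i , j) = S ∩ λ y → near (c i) y (δ j)
        Sparse : ℕ × ℕ → Pred Carrier 0ℓ
        Sparse k x = x ∈ Patch k × Countable (Patch k)
        sparse-countable : ∀ k → Countable (Sparse k)
        sparse-countable k with em {P = Countable (Patch k)}
        ... | yes count = countable-⊆ proj₁ count
        ... | no ¬count = (λ _ → 0) , λ (_ , count) → contradiction count ¬count
        locate : ∀ {x} → x ∈ S ∖ Condensation S → ∃ λ k → x ∈ Sparse k
        locate {x} (x∈S , ¬cond) =
          let ε , 0<ε , count = by-contradiction λ ∄ → ¬cond λ ε 0<ε count → ∄ (ε , 0<ε , count)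
              η , 0<η , η+η≡ε = half 0<ε
              j , δ≤η         = δ-small 0<η
              i , x~ci        = c-dense x (δ>0 j)
          in (i , j) , (x∈S , near-sym x~ci) , countable-⊆ (λ (y∈S , ci~y) → y∈S ,
               subst (near x _) η+η≡ε (near-mono (ℚ.+-mono-≤ δ≤η δ≤η) (near-tri x~ci ci~y))) count

      condensation-uncountable : ∀ {S} → ¬ Countable S → ¬ Countable (S ∩ Condensation S)
      condensation-uncountable {S} unc count = unc (countable-⋃ {J = Bool}
        (λ b → if b then S ∩ Condensation S else S ∖ Condensation S)
        (mk↣ (λ {b} {b′} → toℕ-injective b b′))
        (λ where
          true  → count
          false → countable-noncondensation S)
        λ {x} x∈S → case em {P = x ∈ Condensation S} of λ where
          (yes cond) → true , x∈S , cond
          (no ¬cond) → false , x∈S , ¬cond)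
        where
        toℕ : Bool → ℕ
        toℕ b = if b then 0 else 1
        toℕ-injective : ∀ b b′ → toℕ b ≡ toℕ b′ → b ≡ b′
        toℕ-injective true  true  _ = refl
        toℕ-injective false false _ = refl

      two-points : {P : Pred Carrier 0ℓ} → ¬ Countable P → ∃₂ λ x y → x ∈ P × y ∈ P × x ≢ y
      two-points unc = by-contradiction λ ∄ → unc ((λ _ → 0) , λ {x} {y} x∈P y∈P _ →
        by-contradiction λ x≢y → ∄ (x , y , x∈P , y∈P , x≢y))

      -- A limit is within 2r of each centre on its branch: one radius to a late point, one from
      -- there to the limit. Centres more than 4r apart therefore keep limits through different
      -- children distinct. The bound `δ n` makes branches Cauchy.
      record Split (n : ℕ) (S : Pred Carrier 0ℓ) : Set where
        field
          centre      : Bool → Carrier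
          radius      : ℚ
          0<radius    : 0ℚ ℚ.< radius
          radius≤δ    : radius ℚ.≤ δ n
          apart       : ¬ near (centre true) (centre false) (quadruple radius)
          uncountable : ∀ b → ¬ Countable (S ∩ λ y → near (centre b) y radius)
      open Split

      abstract
        split : ∀ n {S} → ¬ Countable S → Split n S
        split n {S} unc =
          -- Both points are condensation points, so every radius keeps uncountably many points of S
          -- around them, and the radius may shrink to meet the other two bounds.
          let x , y , (_ , x-cond) , (_ , y-cond) , x≢y = two-points (condensation-uncountable unc)
              ε , 0<ε , far = separated x≢y
              ζ , 0<ζ , 4ζ≡ε = quarter 0<ε
          in record
            { centre      = λ b → if b then x else y
            ; radius      = ζ ℚ.⊓ δ n
            ; 0<radius    = 0<⊓ 0<ζ (δ>0 n)
            ; radius≤δ    = ℚ.p⊓q≤q ζ (δ n)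
            ; apart       = λ x~y → far (subst (near x y) 4ζ≡ε
                              (near-mono (quadruple-mono (ℚ.p⊓q≤p ζ (δ n))) x~y))
            ; uncountable = λ where
                true  → x-cond _ (0<⊓ 0<ζ (δ>0 n))
                false → y-cond _ (0<⊓ 0<ζ (δ>0 n))
            }
          where
          0<⊓ : ∀ {p q} → 0ℚ ℚ.< p → 0ℚ ℚ.< q → 0ℚ ℚ.< p ℚ.⊓ q
          0<⊓ {p} {q} 0<p 0<q with ℚ.⊓-sel p q
          ... | inj₁ eq = subst (0ℚ ℚ.<_) (sym eq) 0<p
          ... | inj₂ eq = subst (0ℚ ℚ.<_) (sym eq) 0<q

      Node : Set₁
      Node = ∃ λ (S : Pred Carrier 0ℓ) → ¬ Countable S

      splitNode : ∀ n (P : Node) → Split n (proj₁ P)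
      splitNode n (_ , unc) = split n unc

      child : ℕ → Node → Bool → Node
      child n P b = _ , uncountable (splitNode n P) b

      module _ (X-uncountable : Uncountable X) where

        path : C → ℕ → Node
        path f zero    = U , X-uncountable
        path f (suc n) = child n (path f n) (f n)

        node-centre : ℕ → Node → Bool → Carrier
        node-centre n P = centre (splitNode n P)

        node-diameter : ℕ → Node → ℚ
        node-diameter n P = radius (splitNode n P) ℚ.+ radius (splitNode n P)

        node-point : (P : Node) → ∃ (_∈ proj₁ P)
        node-point (_ , unc) = let x , _ , x∈P , _ = two-points unc in x , x∈P

        point : C → ℕ → Carrier
        point f n = proj₁ (node-point (path f n))

        path-⊆ : ∀ f {m n} → m ℕ.≤′ n → proj₁ (path f n) ⊆ proj₁ (path f m)
        path-⊆ f ℕ.≤′-refl       x∈ = x∈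
        path-⊆ f (ℕ.≤′-step m≤n) x∈ = path-⊆ f m≤n (proj₁ x∈)

        point-near : ∀ f n m → n ℕ.< m →
          near (node-centre n (path f n) (f n)) (point f m) (radius (splitNode n (path f n)))
        point-near f n m n<m = proj₂ (path-⊆ f (ℕ.≤⇒≤′ n<m) (proj₂ (node-point (path f m))))

        2r+2r≤4δ : ∀ n P → node-diameter n P ℚ.+ node-diameter n P ℚ.≤ quadruple (δ n)
        2r+2r≤4δ n P = quadruple-mono (radius≤δ (splitNode n P))

        2r≤4δ : ∀ n P → node-diameter n P ℚ.≤ quadruple (δ n)
        2r≤4δ n P = ℚ.≤-trans (ℚ.+-mono-≤ (radius≤δ (splitNode n P)) (radius≤δ (splitNode n P)))
          (ℚ.<⇒≤ (q<q+q (ℚ.<-trans (δ>0 n) (q<q+q (δ>0 n)))))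

        abstract
          converges : ∀ f → ∃ λ x → ∀ ε → 0ℚ ℚ.< ε → ∃ λ N → ∀ n → N ℕ.≤ n → near (point f n) x ε
          converges f = complete (point f) λ ε 0<ε → let n , 4δ≤ε = δ-quarter 0<ε in
            suc n , λ i j n<i n<j → near-mono (ℚ.≤-trans (2r≤4δ n (path f n)) 4δ≤ε)
              (near-tri (near-sym (point-near f n i n<i)) (point-near f n j n<j))

        limit : C → Carrier
        limit f = proj₁ (converges f)

        limit-near : ∀ f n →
          near (node-centre n (path f n) (f n)) (limit f) (node-diameter n (path f n))
        limit-near f n =
          let N , close = proj₂ (converges f) _ (0<radius (splitNode n (path f n)))
          in near-tri (point-near f n (N ℕ.⊔ suc n) (ℕ.m≤n⊔m N (suc n)))
                      (close (N ℕ.⊔ suc n) (ℕ.m≤m⊔n N (suc n)))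

        path-cong : ∀ n {f g} → Agree n f g → path f n ≡ path g n
        path-cong zero    _          = refl
        path-cong (suc n) (agr , eq) = cong₂ (child n) (path-cong n agr) eq

        limit-near′ : ∀ {f g} n → Agree n f g →
          near (node-centre n (path f n) (g n)) (limit g) (node-diameter n (path f n))
        limit-near′ {g = g} n agr =
          subst (λ P → near (node-centre n P (g n)) (limit g) (node-diameter n P))
            (sym (path-cong n agr)) (limit-near g n)

        limit-continuous : ∀ {V} → Open V → C-Open (V ∘ limit)
        limit-continuous V-open {f} f∈V =
          let ε , 0<ε , ball = open⇒ball V-open f∈V
              n , 4δ≤ε = δ-quarter 0<ε
          -- Agreement in coordinate n too, hence `suc n`, selects the same child, so both limits
          -- are within 2r of one centre.
          in suc n , λ {g} (agr , eq) → ball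
            (near-mono (ℚ.≤-trans (2r+2r≤4δ n (path f n)) 4δ≤ε)
              (near-tri (near-sym (limit-near f n))
                (subst (λ b → near (node-centre n (path f n) b) (limit g) (node-diameter n (path f n)))
                  (sym eq) (limit-near′ n agr))))

        centres-apart : ∀ n P {a b} → a ≢ b →
          ¬ near (node-centre n P a) (node-centre n P b) (node-diameter n P ℚ.+ node-diameter n P)
        centres-apart n P {true}  {true}  a≢b = contradiction refl a≢b
        centres-apart n P {true}  {false} _   = apart (splitNode n P)
        centres-apart n P {false} {true}  _   = apart (splitNode n P) ∘ near-sym
        centres-apart n P {false} {false} a≢b = contradiction refl a≢b

        limit-agree : ∀ {f g} → limit f ≡ limit g → ∀ n → Agree n f g
        limit-agree eq zero = tt
        limit-agree {f} {g} eq (suc n) = agr , by-contradiction λ f≢g →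
          centres-apart n (path f n) f≢g
            (near-tri (subst (λ x → near (node-centre n (path f n) (f n)) x (node-diameter n (path f n))) eq
              (limit-near f n)) (near-sym (limit-near′ n agr)))
          where agr = limit-agree eq n

        C↣X : C ↣ Carrier
        C↣X = mk↣ λ eq → ext λ n → proj₂ (limit-agree eq (suc n))

        cover-restrict : ∀ {κ} → Cover Open κ → Cover C-Open κ
        cover-restrict cov = record
          { member = λ i → member cov i ∘ limit
          ; isOpen = λ i → limit-continuous (isOpen cov i)
          ; splits = λ s → splits cov (C↣X ↣-∘ s)
          }

  -- Coding points by generic radii

  module Radii {X : Space} (M : RationalMetric X) {c : ℕ → Space.Carrier X}
    (c-dense : DenseSequence M c) where
    open Space X
    open RationalMetric M
    open ω₁ using (T)

    abstract
      -- A radius above `δ j` captures every point within `δ j` of the centre; a radius of at most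
      -- twice `δ j` leaves out all points farther than that. `separating` rests on both bounds.
      radii : ∀ j → ∃ λ (r : T ↣ (ℚ → Bool)) → ∀ t → IsCut (δ j) (δ j ℚ.+ δ j) (r ⟪ t ⟫)
      radii j = ω₁.minimal (cuts-uncountable (q<q+q (δ>0 j)))

    radius : T → ℕ → ℚ → Bool
    radius t k = proj₁ (radii (proj₂ (unpair k))) ⟪ t ⟫

    radius-cut : ∀ t k → IsCut (δ (proj₂ (unpair k))) (δ (proj₂ (unpair k)) ℚ.+ δ (proj₂ (unpair k))) (radius t k)
    radius-cut t k = proj₂ (radii (proj₂ (unpair k))) t

    centre : ℕ → Carrier
    centre k = c (proj₁ (unpair k))

    -- The open ball of the k-th centre of radius radius t k, and the exterior of
    -- the corresponding closed ball.
    Side : T → ℕ → Bool → Pred Carrier 0ℓ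
    Side t k true  x = ∃ λ u → near x (centre k) u × radius t k u ≡ true
    Side t k false x = ∃ λ u → ¬ near x (centre k) u × radius t k u ≡ false

    side-open : ∀ t k b → Open (Side t k b)
    side-open t k true = balls⇒open λ {x} (u , x~c , u∈r) →
      let v , u<v , v∈r = IsCut.open′ (radius-cut t k) u∈r
          ε , 0<ε , u+ε≡v = gap u<v
      in ε , 0<ε , λ x~y → v , subst (near _ _) (trans (ℚ.+-comm ε u) u+ε≡v)
           (near-tri (near-sym x~y) x~c) , v∈r
    side-open t k false = balls⇒open λ {x} (u , x≁c , u∉r) →
      let v , u<v , x≁v = far-open x≁c
          ε , 0<ε , u+ε≡v = gap u<v
      in ε , 0<ε , λ x~y → u , (λ y~c → x≁v (subst (near _ _) (trans (ℚ.+-comm ε u) u+ε≡v)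
           (near-tri x~y y~c))) , u∉r

    sides-disjoint : ∀ t k {x} → x ∈ Side t k true → x ∉ Side t k false
    sides-disjoint t k (u , x~c , u∈r) (v , x≁c , v∉r) =
      x≁c (near-mono (ℚ.≮⇒≥ λ v<u → case trans (sym v∉r) (IsCut.down (radius-cut t k) v<u u∈r) of λ ()) x~c)

    OnBoundary : T → ℕ → Pred Carrier 0ℓ
    OnBoundary t k x = ∀ b → x ∉ Side t k b

    -- On the boundary the radius is exactly the lower cut of the distance from x to the centre, and
    -- distinct parameters have distinct radii.
    boundary-unique : ∀ {s t} k {x} → x ∈ OnBoundary s k → x ∈ OnBoundary t k → s ≡ t
    boundary-unique {s} {t} k {x} on-s on-t = injective (proj₁ (radii (proj₂ (unpair k))))
      (Bool-ext (λ u → far⇒∈ on-t ∘ ∈⇒far on-s) (λ u → far⇒∈ on-s ∘ ∈⇒far on-t))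
      where
      ∈⇒far : ∀ {t u} → x ∈ OnBoundary t k → radius t k u ≡ true → ¬ near x (centre k) u
      ∈⇒far on u∈r x~c = on true (_ , x~c , u∈r)
      far⇒∈ : ∀ {t u} → x ∈ OnBoundary t k → ¬ near x (centre k) u → radius t k u ≡ true
      far⇒∈ on far = by-contradiction λ u∉r → on false (_ , far , Bool.¬-not u∉r)

    Generic : T → Pred Carrier 0ℓ
    Generic t x = ∀ k → x ∉ OnBoundary t k

    generic-parameter : (s : ℕ → Carrier) → ∃ λ t → ∀ n → s n ∈ Generic t
    generic-parameter s = by-contradiction λ ∄ → ω₁.uncountable (countable-⋃
      (λ (n , k) t → s n ∈ OnBoundary t k) ℕ×ℕ↣ℕ
      (λ (n , k) → (λ _ → 0) , λ on on′ _ → boundary-unique k on on′)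
      λ {t} _ → by-contradiction λ none → ∄ (t , λ n k on → none ((n , k) , on)))

    code : T → Carrier → C
    code t x k = χ (Side t k true) x

    side⇒code : ∀ t {x} k b → x ∈ Side t k b → code t x k ≡ b
    side⇒code t k true  x∈ = χ⁺ (Side t k true) x∈
    side⇒code t k false x∈ = χ⁺-false (Side t k true) λ x∈′ → sides-disjoint t k x∈′ x∈

    code⇒side : ∀ {t x} → x ∈ Generic t → ∀ k → x ∈ Side t k (code t x k)
    code⇒side {t} {x} gen k with em {P = x ∈ Side t k true}
    ... | yes x∈ = x∈
    ... | no x∉  = by-contradiction λ x∉′ → gen k λ where
      true  → x∉
      false → x∉′

    -- With `c i` within `δ j` of x, a y within twice `δ j` of `c i` would be at distance at most
    -- three times `δ j` from x, too close by the choice of j. The bounds on the radii make this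
    -- work for every t, at generic and other points alike.
    separating : ∀ t {x y} → x ≢ y → ∃ λ k → x ∈ Side t k true × y ∈ Side t k false
    separating t {x} {y} x≢y =
      let ε , 0<ε , x≁y = separated x≢y
          j , 4δ≤ε = δ-quarter 0<ε
          i , x~c  = c-dense x (δ>0 j)
          k , eq   = unpair-surj _ i j refl
          y≁c : ¬ near y (c i) (δ j ℚ.+ δ j)
          y≁c y~c = x≁y (near-mono (ℚ.≤-trans (ℚ.+-monoˡ-≤ (δ j ℚ.+ δ j) (ℚ.<⇒≤ (q<q+q (δ>0 j)))) 4δ≤ε)
                      (near-tri x~c (near-sym y~c)))
      in k , (δ (proj₂ (unpair k)) , subst (λ (i , j) → near x (c i) (δ j)) (sym eq) x~c ,
              IsCut.low (radius-cut t k)) ,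
             (δ (proj₂ (unpair k)) ℚ.+ δ (proj₂ (unpair k)) ,
              subst (λ (i , j) → ¬ near y (c i) (δ j ℚ.+ δ j)) (sym eq) y≁c ,
              IsCut.high (radius-cut t k))

    code-injective : ∀ t {x y} → code t x ≡ code t y → x ≡ y
    code-injective t eq = by-contradiction λ x≢y →
      let k , x∈ , y∈ = separating t x≢y in
      case trans (sym (side⇒code t k true x∈)) (trans (cong (λ z → z k) eq) (side⇒code t k false y∈)) of λ ()

    Box : T → C → ℕ → Pred Carrier 0ℓ
    Box t z zero    = U
    Box t z (suc n) = Box t z n ∩ Side t n (z n)

    box-open : ∀ t z n → Open (Box t z n)
    box-open t z zero    = open-U
    box-open t z (suc n) = open-∩ (box-open t z n) (side-open t n (z n))

    box⇒agree : ∀ t z n {x} → x ∈ Box t z n → Agree n z (code t x)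
    box⇒agree t z zero    _         = tt
    box⇒agree t z (suc n) (x∈ , x∈ₙ) = box⇒agree t z n x∈ , sym (side⇒code t n (z n) x∈ₙ)

    generic⇒box : ∀ {t x} n → x ∈ Generic t → x ∈ Box t (code t x) n
    generic⇒box zero    gen = tt
    generic⇒box (suc n) gen = generic⇒box n gen , code⇒side gen n

    Cylinder : Pred C 0ℓ → Set
    Cylinder W = ∃₂ λ n z → ∀ {z′} → Agree n z z′ → z′ ∈ W

    -- An open set of X that agrees on the points generic for t with the preimage
    -- of W under code t.
    Pullback : T → Pred C 0ℓ → Pred Carrier 0ℓ
    Pullback t W = ⋃ (Cylinder W) λ (n , z , _) → Box t z n

    cover-pullback : ∀ {κ} → Cover C-Open κ → Cover Open (κ × T)
    cover-pullback cov = record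
      { member = λ (i , t) → Pullback t (member cov i)
      ; isOpen = λ (i , t) → open-⋃ _ _ λ (n , z , _) → box-open t z n
      ; splits = λ s →
          let t , gen = generic-parameter (s ⟪_⟫)
              s′ = mk↣ {to = λ n → code t (s ⟪ n ⟫)} λ eq → injective s (code-injective t eq)
              i , spl = splits cov s′
          in (i , t) , splitsSeq-cong (member cov i) (s′ ⟪_⟫) (Pullback t (member cov i)) (s ⟪_⟫)
               -- Genericity puts the point in every box of its own code. Conversely, lying in a box
               -- fixes the first n digits of the code at any point.
               (λ m ∈W → let n , cyl = isOpen cov i ∈W in (n , _ , cyl) , generic⇒box n (gen m))
               (λ m ((n , z , cyl) , ∈box) → cyl (box⇒agree t z n ∈box)) spl
      }

  -- The splitting number of an uncountable Polish space

  separable-cover : {X : Space} (M : RationalMetric X) {c : ℕ → Space.Carrier X} → DenseSequence M c →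
    ∀ {κ} → Cover C-Open κ → Cover (Space.Open X) κ
  separable-cover M c-dense {κ} cov =
    cover-↣ (i₀ , t₀) (uncountable-absorbs-T (cover⇒uncountable s₀ cov)) (Radii.cover-pullback M c-dense cov)
    where
    s₀ = uncountable⇒sequence cantor
    i₀ = proj₁ (splits cov s₀)
    t₀ = uncountable⇒sequence ω₁.uncountable ⟪ 0 ⟫

  -- `κ` is the least size of a cover of C, fixed before X is given, so any two spaces share it.
  splitting-number : ∃ λ κ → (X : Space) → Polish X → Uncountable X → κ Is𝔰 X
  splitting-number = let κ , cov , least = least-cover in κ , λ X (sep , met) unc →
    let M           = rational-metric {X} met
        c , c-dense = dense-sequence M sep (uncountable⇒sequence unc ⟪ 0 ⟫)
        restrict    = CantorScheme.cover-restrict M c-dense unc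
        i₀          = proj₁ (splits cov (uncountable⇒sequence cantor))
    in least-cover⇒splittingFamily i₀ (separable-cover M c-dense cov) (λ μ → least μ ∘ restrict) ,
       λ μ F → least μ (restrict (splittingFamily⇒cover F))

theorem2p5 : (∀ {ℓ} → ExcludedMiddle ℓ) →
    (∀ {a b} → Extensionality a b) →
    (X Y : Space) →
    Polish X → Uncountable X →
    Polish Y → Uncountable Y →
    ∃[ κ ] (κ Is𝔰 X × κ Is𝔰 Y)
theorem2p5 em ext X Y X-polish X-unc Y-polish Y-unc =
  let κ , κ-is𝔰 = Classical.splitting-number em ext in
  κ , κ-is𝔰 X X-polish X-unc , κ-is𝔰 Y Y-polish Y-unc
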